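{- For integers $a,b\geq 1$ with $a+b\geq 3$, the graph $\mathcal{F}_{(a,b)}$ is isomorphic to the flip graph of $(a-1,b-1)$-combinations under adjacent transpositions. Consequently, $\mathcal{F}_{(a,b)}$ has a Hamilton path if and only if $a\in\{1,2\}$, or $b\in\{1,2\}$, or $a$ and $b$ are both even. Furthermore, if $a,b\geq 2$, then $\mathcal{F}_{(a,b)}$ has no Hamilton cycle.
   Context: Let $N=a+b$ and label the points of a convex $N$-gon $1,\ldots,N$ counterclockwise; color the first $a$ points red and the remaining $b$ points blue. The associahedron $\mathcal{G}_N$ has as nodes all triangulations of the convex $N$-gon, two adjacent if they differ in a flip (removing a diagonal shared by two triangles and replacing it by the other diagonal of the resulting quadrilateral). A triangulation is colorful if no triangle has all three points of the same color; $\mathcal{F}_{(a,b)}$ is the subgraph of $\mathcal{G}_N$ induced by the colorful triangulations. An $(a-1,b-1)$-combination is a bitstring of length $N-2$ with exactly $a-1$ zeros and $b-1$ ones; the flip graph of these under adjacent transpositions has an edge between two such bitstrings if one arises from the other by swapping two adjacent (distinct) bits. -}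

module Defs where

open import Data.Bool using (Bool; true; false; _∧_; _∨_; not)
open import Data.Nat using (ℕ; zero; suc; _+_; _∸_; _≤_; _≡ᵇ_; _<ᵇ_; _≤ᵇ_)
open import Data.Fin using (Fin; toℕ)
open import Data.Vec using (Vec; lookup; _[_]≔_)
open import Data.List using (List; []; _∷_; allFin; length; _∷ʳ_)
open import Data.Bool.ListAction using (all; any)
open import Data.List.Relation.Unary.Unique.Propositional using (Unique)
open import Data.List.Relation.Unary.Linked using (Linked)
open import Data.List.Membership.Propositional using (_∈_)
open import Data.Empty using (⊥)
open import Data.Product using (Σ; ∃; _×_; _,_; proj₁)
open import Function.Bundles using (_↔_; Inverse)
open import Relation.Binary.PropositionalEquality using (_≡_)

record Graph : Set₁ where
  field
    V   : Set
    Adj : V → V → Set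
open Graph public

Isomorphic : Graph → Graph → Set
Isomorphic G H =
  Σ (V G ↔ V H) λ f →
    ∀ u v → (Adj G u v → Adj H (Inverse.to f u) (Inverse.to f v))
          × (Adj H (Inverse.to f u) (Inverse.to f v) → Adj G u v)

HamiltonPath : Graph → Set
HamiltonPath G =
  Σ (List (V G)) λ vs → Unique vs × (∀ v → v ∈ vs) × Linked (Adj G) vs

HamiltonCycle : Graph → Set
HamiltonCycle G =
  Σ (V G) λ v → Σ (List (V G)) λ rest →
    3 ≤ length (v ∷ rest) × Unique (v ∷ rest) × (∀ w → w ∈ (v ∷ rest))
    × Linked (Adj G) ((v ∷ rest) ∷ʳ v)

-- Triangulations of a convex N-gon.  Points are 0,…,N-1 (point k+1 of the
-- paper is index k), in counterclockwise order.  A set of diagonals is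
-- encoded by an N×N Boolean matrix D, where D[i][j] = true (for i < j)
-- means the segment {i,j} is in the set.

Mat : ℕ → Set
Mat N = Vec (Vec Bool N) N

module _ {N : ℕ} where

  edge : Mat N → Fin N → Fin N → Bool
  edge D i j = lookup (lookup D i) j

  setE : Mat N → Fin N → Fin N → Bool → Mat N
  setE D i j b = D [ i ]≔ (lookup D i [ j ]≔ b)

  all1 : (Fin N → Bool) → Bool
  all1 f = all f (allFin N)

  any1 : (Fin N → Bool) → Bool
  any1 f = any f (allFin N)

  isSide : Fin N → Fin N → Bool
  isSide i j = (suc (toℕ i) ≡ᵇ toℕ j) ∨ ((toℕ i ≡ᵇ 0) ∧ (suc (toℕ j) ≡ᵇ N))

  isDiag : Fin N → Fin N → Bool
  isDiag i j = (suc (toℕ i) <ᵇ toℕ j) ∧ not ((toℕ i ≡ᵇ 0) ∧ (suc (toℕ j) ≡ᵇ N))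

  crosses : Fin N → Fin N → Fin N → Fin N → Bool
  crosses i j k l =
    ((toℕ i <ᵇ toℕ k) ∧ (toℕ k <ᵇ toℕ j) ∧ (toℕ j <ᵇ toℕ l)) ∨
    ((toℕ k <ᵇ toℕ i) ∧ (toℕ i <ᵇ toℕ l) ∧ (toℕ l <ᵇ toℕ j))

  wellFormed : Mat N → Bool
  wellFormed D = all1 λ i → all1 λ j → not (edge D i j) ∨ isDiag i j

  nonCrossing : Mat N → Bool
  nonCrossing D = all1 λ i → all1 λ j → all1 λ k → all1 λ l →
    not (edge D i j ∧ edge D k l ∧ crosses i j k l)

  maximal : Mat N → Bool
  maximal D = all1 λ i → all1 λ j →
    not (isDiag i j ∧ not (edge D i j)) ∨
    (any1 λ k → any1 λ l → edge D k l ∧ crosses i j k l)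

  isTriangulation : Mat N → Bool
  isTriangulation D = wellFormed D ∧ nonCrossing D ∧ maximal D

  seg : Mat N → Fin N → Fin N → Bool
  seg D i j = isSide i j ∨ edge D i j

  isTriangle : Mat N → Fin N → Fin N → Fin N → Bool
  isTriangle D i j k =
    (toℕ i <ᵇ toℕ j) ∧ (toℕ j <ᵇ toℕ k) ∧ seg D i j ∧ seg D j k ∧ seg D i k

  red : ℕ → Fin N → Bool
  red a i = toℕ i <ᵇ a

  monochromatic : ℕ → Fin N → Fin N → Fin N → Bool
  monochromatic a i j k =
    (red a i ∧ red a j ∧ red a k) ∨ (not (red a i) ∧ not (red a j) ∧ not (red a k))

  colorful : ℕ → Mat N → Bool
  colorful a D = all1 λ i → all1 λ j → all1 λ k →
    not (isTriangle D i j k ∧ monochromatic a i j k)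

  -- D' arises from D by a flip: remove diagonal {i,j} and add another
  -- diagonal {k,l} (both D and D' being triangulations, {k,l} is then
  -- necessarily the other diagonal of the quadrilateral).
  Flip : Mat N → Mat N → Set
  Flip D D' = Σ (Fin N) λ i → Σ (Fin N) λ j → Σ (Fin N) λ k → Σ (Fin N) λ l →
    edge D i j ≡ true × edge D k l ≡ false × D' ≡ setE (setE D i j false) k l true

F : ℕ → ℕ → Graph
F a b = record
  { V   = Σ (Mat (a + b)) λ D → (isTriangulation D ∧ colorful a D) ≡ true
  ; Adj = λ D D' → Flip (proj₁ D) (proj₁ D')
  }

count : Bool → List Bool → ℕ
count c [] = 0
count true  (true  ∷ xs) = suc (count true xs)
count true  (false ∷ xs) = count true xs
count false (false ∷ xs) = suc (count false xs)
count false (true  ∷ xs) = count false xs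

data AdjSwap : List Bool → List Bool → Set where
  here  : ∀ {x y xs} → (x ≡ y → ⊥) → AdjSwap (x ∷ y ∷ xs) (y ∷ x ∷ xs)
  there : ∀ {x xs ys} → AdjSwap xs ys → AdjSwap (x ∷ xs) (x ∷ ys)

Comb : ℕ → ℕ → Graph
Comb s t = record
  { V   = Σ (List Bool) λ w → (length w ≡ s + t) × (count false w ≡ s) × (count true w ≡ t)
  ; Adj = λ u v → AdjSwap (proj₁ u) (proj₁ v)
  }

{-# OPTIONS --safe #-}

-- Every diagonal of a colorful triangulation joins a red to a blue point, since a monochromatic one
-- would cut off a monochromatic triangle. Ordered from the side {0 , N-1} to the side {a-1 , a}, the
-- diagonals form a lattice path in which each triangle advances either the red or the blue endpoint;
-- the word of these steps is an (a-1, b-1)-combination, and a flip exchanges two consecutive steps.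
--
-- The graph of combinations is bipartite by inversion parity. Swapping the first unequal pair among
-- the letters 1,2 | 3,4 | ... matches the odd words into the even ones, and unless both letter
-- counts are odd it leaves at least two even words unmatched once both counts are at least 2, so
-- there is no Hamilton path. If both counts are odd, a path from 1..10..0 to 0..01..1 is built by
-- recursion on the first two letters. The word 0..01..1 has a single neighbour, which excludes
-- Hamilton cycles.
module Submission where

open import Defs
open import Algebra.Properties.CommutativeSemigroup using (interchange; xy∙z≈xz∙y)
open import Axiom.UniquenessOfIdentityProofs using (module Decidable⇒UIP)
open import Data.Bool using (Bool; true; false; not; _∧_; _xor_; if_then_else_; T)
open import Data.Bool.Properties as Bool using (not-involutive)
open import Data.Empty using (⊥-elim)
open import Data.Fin using (Fin; toℕ; fromℕ<)
open import Data.Fin.Properties using (toℕ<n; toℕ-fromℕ<; fromℕ<-toℕ; toℕ-injective) renaming (_≟_ to _≟ᶠ_)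
open import Data.List as List using (List; []; _∷_; _++_; _∷ʳ_; allFin; filter; length; replicate)
open import Data.List.Membership.Propositional using (_∈_; _∉_; find; lose)
open import Data.List.Membership.Propositional.Properties using (∈-allFin; ∈-map⁺; ∈-map⁻; ∈-∃++; ∈-++⁺ˡ; ∈-++⁺ʳ; ∈-++⁻; ∈-filter⁺; ∈-filter⁻)
open import Data.List.Properties using (≡-dec; length-map; length-++; map-++)
open import Data.List.Relation.Unary.All as All using (All; []; _∷_)
open import Data.List.Relation.Unary.All.Properties as All using (¬Any⇒All¬; All¬⇒¬Any)
open import Data.List.Relation.Unary.AllPairs using ([]; _∷_)
open import Data.List.Relation.Unary.Any using (here; there)
import Data.List.Relation.Unary.Any.Properties as Any
open import Data.List.Relation.Unary.Linked as Linked using (Linked; []; [-]; _∷_)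
import Data.List.Relation.Unary.Linked.Properties as Linked
open import Data.List.Relation.Unary.Unique.Propositional using (Unique)
import Data.List.Relation.Unary.Unique.Propositional.Properties as Unique
open import Data.Nat using (ℕ; zero; suc; _+_; _*_; _∸_; _≤_; _<_; z≤n; s≤s)
open import Data.Nat.Divisibility using (_∣_; divides)
open import Data.Nat.Properties
open import Data.Product using (Σ; ∃; _×_; _,_; proj₁; proj₂)
open import Data.Sum using (_⊎_; inj₁; inj₂; [_,_]′)
open import Data.Vec using (Vec; lookup; tabulate)
open import Data.Vec.Properties using (lookup∘tabulate; tabulate∘lookup; tabulate-cong; lookup∘update; lookup∘update′)
open import Function using (_∘_)
open import Function.Bundles using (Inverse; mk↔ₛ′)
open import Relation.Binary.Definitions using (DecidableEquality; Symmetric; tri<; tri≈; tri>)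
open import Relation.Binary.PropositionalEquality hiding ([_])
open import Relation.Nullary using (¬_; Dec; yes; no; does; _because_)
open import Relation.Nullary.Decidable using (_×-dec_; _⊎-dec_; _→-dec_; ¬?; T?)
open import Relation.Nullary.Reflects using (fromEquivalence)

-- Walks and prisms

-- The case of odd counts cannot be settled by recursion on the graphs of words alone. After a first
-- pair 10 or 01 the remaining word has even letter counts, and unless one of them is 0 the matching
-- argument shows that the graph of these remainders has no Hamilton path. The two mixed pairs,
-- however, provide two copies of that graph joined by rungs. A rung reverses the parity of
-- inversions, so this prism is balanced, and prisms are therefore covered along with words. Over a
-- walk, a prism is traversed by taking the rungs up and down in turn; start and end are on the same
-- level only if the walk has an even number of vertices, which holds because 1..10..0 has an odd
-- number of inversions when both counts are odd.
--
-- Visits are counted by sums over walks: such sums are additive under splicing, so the order of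
-- visits never has to be inspected.
--
-- For the isomorphism, flips and swaps are compared through the points of lattice paths: either one
-- removes a single point and keeps the others. The two ends of the path stand for the sides {0 ,
-- N-1} and {a-1 , a}, its other points for diagonals.

data Walk {A : Set} (R : A → A → Set) : A → A → Set where
  [_]     : ∀ x → Walk R x x
  _∷⟨_⟩_ : ∀ x {y z} → R x y → Walk R y z → Walk R x z

infixr 5 _∷⟨_⟩_ _▹⟨_⟩_

_▹⟨_⟩_ : ∀ {A : Set} {R : A → A → Set} {x y z w} → Walk R x y → R y z → Walk R z w → Walk R x w
[ x ]         ▹⟨ s ⟩ q = x ∷⟨ s ⟩ q
(x ∷⟨ r ⟩ p) ▹⟨ s ⟩ q = x ∷⟨ r ⟩ (p ▹⟨ s ⟩ q)

reverse : ∀ {A : Set} {R : A → A → Set} {x y} → Symmetric R → Walk R x y → Walk R y x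
reverse s [ x ]         = [ x ]
reverse s (x ∷⟨ r ⟩ p) = reverse s p ▹⟨ s r ⟩ [ x ]

map : ∀ {A : Set} {B : Set} {R : A → A → Set} {S : B → B → Set} {x y} (f : A → B) →
      (∀ {x y} → R x y → S (f x) (f y)) → Walk R x y → Walk S (f x) (f y)
map f m [ x ]         = [ f x ]
map f m (x ∷⟨ r ⟩ p) = f x ∷⟨ m r ⟩ map f m p

-- For an indicator function `g` this is a number of visits, which makes "visited exactly once" an
-- equation that can be computed piece by piece.
total : ∀ {A : Set} {R : A → A → Set} {x y} → (A → ℕ) → Walk R x y → ℕ
total g [ x ]         = g x
total g (x ∷⟨ _ ⟩ p) = g x + total g p

total-▹ : ∀ {A : Set} {R : A → A → Set} {x y z w} (g : A → ℕ) (p : Walk R x y) {r : R y z}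
      (q : Walk R z w) →
          total g (p ▹⟨ r ⟩ q) ≡ total g p + total g q
total-▹ g [ x ]         q = refl
total-▹ g (x ∷⟨ _ ⟩ p) q =
  trans (cong (g x +_) (total-▹ g p q)) (sym (+-assoc (g x) _ _))

total-reverse : ∀ {A : Set} {R : A → A → Set} {x y} (g : A → ℕ) (s : Symmetric R) (p : Walk R x y) →
                total g (reverse s p) ≡ total g p
total-reverse g s [ x ]         = refl
total-reverse g s (x ∷⟨ _ ⟩ p) =
  trans (total-▹ g (reverse s p) [ x ])
        (trans (cong (_+ g x) (total-reverse g s p)) (+-comm _ (g x)))

total-map : ∀ {A : Set} {B : Set} {R : A → A → Set} {S : B → B → Set} {x y} (g : B → ℕ) {f : A → B}
      {m : ∀ {x y} → R x y → S (f x) (f y)}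
            (p : Walk R x y) → total g (map {S = S} f m p) ≡ total (λ x → g (f x)) p
total-map g     [ x ]         = refl
total-map g {f} (x ∷⟨ _ ⟩ p) = cong (g (f x) +_) (total-map g p)

total-cong : ∀ {A : Set} {R : A → A → Set} {x y} {g h : A → ℕ} → (∀ x → g x ≡ h x) → (p : Walk R x y) →
      total g p ≡ total h p
total-cong e [ x ]         = e x
total-cong e (x ∷⟨ _ ⟩ p) = cong₂ _+_ (e x) (total-cong e p)

total-+ : ∀ {A : Set} {R : A → A → Set} {x y} (g h : A → ℕ) (p : Walk R x y) →
          total g p + total h p ≡ total (λ x → g x + h x) p
total-+ g h [ x ]         = refl
total-+ g h (x ∷⟨ _ ⟩ p) =
  trans (interchange +-commutativeSemigroup (g x) (total g p) (h x) (total h p))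
        (cong (g x + h x +_) (total-+ g h p))

total-0 : ∀ {A : Set} {R : A → A → Set} {x y} (p : Walk R x y) → total (λ _ → 0) p ≡ 0
total-0 [ x ]         = refl
total-0 (x ∷⟨ _ ⟩ p) = total-0 p

data Prism {A : Set} (R : A → A → Set) : Bool × A → Bool × A → Set where
  rail : ∀ {b x y} → R x y → Prism R (b , x) (b , y)
  rung : ∀ {b x} → Prism R (b , x) (not b , x)

prism-sym : ∀ {A : Set} {R : A → A → Set} → Symmetric R → Symmetric (Prism R)
prism-sym s (rail r)       = rail (s r)
prism-sym s (rung {true})  = rung
prism-sym s (rung {false}) = rung

-- The level on which a snake over the walk ends when it starts on level `b`: one change of level
-- per vertex.
tip : ∀ {A : Set} {R : A → A → Set} {x y} → Walk R x y → Bool → Bool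
tip [ x ]         b = not b
tip (x ∷⟨ _ ⟩ p) b = tip p (not b)

tip-not : ∀ {A : Set} {R : A → A → Set} {x y} (p : Walk R x y) → ∀ b → tip p (not b) ≡ not (tip p b)
tip-not [ x ]         b = refl
tip-not (x ∷⟨ _ ⟩ p) b = tip-not p (not b)

tip-map : ∀ {A : Set} {B : Set} {R : A → A → Set} {S : B → B → Set} {x y} {f : A → B}
      {m : ∀ {x y} → R x y → S (f x) (f y)} (p : Walk R x y) → ∀ b →
          tip (map {S = S} f m p) b ≡ tip p b
tip-map [ x ]         b = refl
tip-map (x ∷⟨ _ ⟩ p) b = tip-map p (not b)

EvenLength : ∀ {A : Set} {R : A → A → Set} {x y} → Walk R x y → Set
EvenLength p = ∀ b → tip p b ≡ b

Detour : ∀ {A : Set} → (A → A → Set) → A → Set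
Detour R y = ∀ b → Walk (Prism R) (b , y) (not b , y)

-- Traverses every rung of the prism over p, alternating directions; the rung over the last vertex
-- is replaced by the detour.
snake : ∀ {A : Set} {R : A → A → Set} {x y} (p : Walk R x y) → Detour R y → ∀ b →
      Walk (Prism R) (b , x) (tip p b , y)
snake [ x ]         d b = d b
snake (x ∷⟨ r ⟩ p) d b = (b , x) ∷⟨ rung ⟩ (not b , x) ∷⟨ rail r ⟩ snake p d (not b)

both : ∀ {A : Set} → (Bool × A → ℕ) → A → ℕ
both g x = g (true , x) + g (false , x)

both-either : ∀ {A : Set} (g : Bool × A → ℕ) b x → g (b , x) + g (not b , x) ≡ both g x
both-either g true  x = refl
both-either g false x = +-comm (g (false , x)) _

-- Here `e` stands for the visits that the detour makes outside the rung over `y`.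
total-snake : ∀ {A : Set} {R : A → A → Set} {x y} (g : Bool × A → ℕ) (p : Walk R x y) (d : Detour R y) {e} →
              (∀ b → total g (d b) ≡ both g y + e) →
              ∀ b → total g (snake p d b) ≡ total (both g) p + e
total-snake g [ x ]         d h b = h b
total-snake g (x ∷⟨ _ ⟩ p) d {e} h b = begin
  g (b , x) + (g (not b , x) + total g (snake p d (not b)))
    ≡⟨ sym (+-assoc (g (b , x)) _ _) ⟩
  g (b , x) + g (not b , x) + total g (snake p d (not b))
    ≡⟨ cong₂ _+_ (both-either g b x) (total-snake g p d h (not b)) ⟩
  both g x + (total (both g) p + e)
    ≡⟨ sym (+-assoc (both g x) _ _) ⟩
  both g x + total (both g) p + e ∎
  where open ≡-Reasoning

fullSnake : ∀ {A : Set} {R : A → A → Set} {x y} (p : Walk R x y) → EvenLength p → Detour R y → ∀ b →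
      Walk (Prism R) (b , x) (b , y)
fullSnake {R = R} {x} {y} p ev d b =
  subst (λ c → Walk (Prism R) (b , x) (c , y)) (ev b) (snake p d b)

total-subst : ∀ {A : Set} {R : A → A → Set} {x} (g : A → ℕ) {I : Set} {f : I → A} {i j : I} (e : i ≡ j)
      (p : Walk R x (f i)) →
              total g (subst (λ c → Walk R x (f c)) e p) ≡ total g p
total-subst g refl p = refl

total-fullSnake : ∀ {A : Set} {R : A → A → Set} {x y} (g : Bool × A → ℕ) (p : Walk R x y)
      (ev : EvenLength p) (d : Detour R y) {e} →
                  (∀ b → total g (d b) ≡ both g y + e) →
                  ∀ b → total g (fullSnake p ev d b) ≡ total (both g) p + e
total-fullSnake g p ev d h b =
  trans (total-subst g (ev b) (snake p d b)) (total-snake g p d h b)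

¬not≡ : ∀ {b} → ¬ not b ≡ b
¬not≡ {true}  ()
¬not≡ {false} ()

-- Omits the vertex (not b , x), so that the snake can be closed up to a Hamilton cycle cut open at
-- the first rung.
openSnake : ∀ {A : Set} {R : A → A → Set} {x y} (p : Walk R x y) → EvenLength p → Detour R y → ∀ b →
      Walk (Prism R) (b , x) (not b , y)
openSnake [ x ] ev d b = ⊥-elim (¬not≡ (ev b))
openSnake {R = R} {x} {y} (x ∷⟨ r ⟩ p) ev d b =
  subst (λ c → Walk (Prism R) (b , x) (c , y))
        (trans (cong (tip p) (sym (not-involutive b))) (ev (not b)))
        ((b , x) ∷⟨ rail r ⟩ snake p d b)

total-openSnake : ∀ {A : Set} {R : A → A → Set} {x y} (g : Bool × A → ℕ) (p : Walk R x y)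
      (ev : EvenLength p) (d : Detour R y) {e} →
                  (∀ b → total g (d b) ≡ both g y + e) →
                  ∀ b → total g (openSnake p ev d b) + g (not b , x) ≡ total (both g) p + e
total-openSnake g [ x ] ev d h b = ⊥-elim (¬not≡ (ev b))
total-openSnake {R = R} {y = y} g (x ∷⟨ r ⟩ p) ev d {e} h b = begin
  total g (openSnake (x ∷⟨ r ⟩ p) ev d b) + g (not b , x)
    ≡⟨ cong (_+ g (not b , x))
         (total-subst g {f = _, y} (trans (cong (tip p) (sym (not-involutive b))) (ev (not b)))
                      ((b , x) ∷⟨ rail r ⟩ snake p d b)) ⟩
  g (b , x) + total g (snake p d b) + g (not b , x)
    ≡⟨ xy∙z≈xz∙y +-commutativeSemigroup (g (b , x)) _ _ ⟩
  g (b , x) + g (not b , x) + total g (snake p d b)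
    ≡⟨ cong₂ _+_ (both-either g b x) (total-snake g p d h b) ⟩
  both g x + (total (both g) p + e)
    ≡⟨ sym (+-assoc (both g x) _ _) ⟩
  both g x + total (both g) p + e ∎
  where open ≡-Reasoning

-- Words under adjacent transpositions

Word : Set
Word = List Bool

swap-sym : Symmetric AdjSwap
swap-sym (here ne)  = here (λ e → ne (sym e))
swap-sym (there s)  = there (swap-sym s)

swap01 : ∀ {u} → AdjSwap (false ∷ true ∷ u) (true ∷ false ∷ u)
swap01 = here (λ ())

swap10 : ∀ {u} → AdjSwap (true ∷ false ∷ u) (false ∷ true ∷ u)
swap10 = here (λ ())

parity : ℕ → Bool
parity zero    = false
parity (suc n) = not (parity n)

-- The parity of the number of inversions.
sgn : Word → Bool
sgn []          = false
sgn (false ∷ u) = sgn u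
sgn (true ∷ u)  = parity (count false u) xor sgn u

count-swap : ∀ c {u v} → AdjSwap u v → count c u ≡ count c v
count-swap c     (here {true}  {true}  _) = refl
count-swap true  (here {true}  {false} _) = refl
count-swap false (here {true}  {false} _) = refl
count-swap true  (here {false} {true}  _) = refl
count-swap false (here {false} {true}  _) = refl
count-swap c     (here {false} {false} _) = refl
count-swap true  (there {true}  s) = cong suc (count-swap true s)
count-swap false (there {true}  s) = count-swap false s
count-swap true  (there {false} s) = count-swap true s
count-swap false (there {false} s) = cong suc (count-swap false s)

sgn-swap : ∀ {u v} → AdjSwap u v → sgn v ≡ not (sgn u)
sgn-swap (here {true}  {true}  ne) = ⊥-elim (ne refl)
sgn-swap (here {false} {false} ne) = ⊥-elim (ne refl)
sgn-swap (here {true}  {false} {u} _) with parity (count false u) | sgn u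
... | true  | true  = refl
... | true  | false = refl
... | false | true  = refl
... | false | false = refl
sgn-swap (here {false} {true}  {u} _) with parity (count false u) | sgn u
... | true  | true  = refl
... | true  | false = refl
... | false | true  = refl
... | false | false = refl
sgn-swap (there {false} s) = sgn-swap s
sgn-swap (there {true} {u} {v} s) rewrite count-swap false s | sgn-swap s
  with parity (count false v)
... | true  = refl
... | false = refl

-- Steps flip the sign and vertices flip the level. Started on level `sgn u`, a snake thus enters
-- each vertex on the level given by its sign, and the last vertex flips once more.
tip-sgn : ∀ {u v} (p : Walk AdjSwap u v) → tip p (sgn u) ≡ not (sgn v)
tip-sgn [ u ]         = refl
tip-sgn (u ∷⟨ r ⟩ p) = trans (cong (tip p) (sym (sgn-swap r))) (tip-sgn p)

evenLength : ∀ {u v} (p : Walk AdjSwap u v) → sgn v ≡ not (sgn u) → EvenLength p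
evenLength {u} {v} p e b with sgn u in eu | tip-sgn p
... | true  | t rewrite e = go b
  where go : ∀ b → tip p b ≡ b
        go true  = t
        go false = trans (tip-not p true) (cong not t)
... | false | t rewrite e = go b
  where go : ∀ b → tip p b ≡ b
        go false = t
        go true  = trans (tip-not p false) (cong not t)

_≟ʷ_ : DecidableEquality Word
_≟ʷ_ = ≡-dec Bool._≟_

⟦_⟧ : {P : Set} → Dec P → ℕ
⟦ d ⟧ = if does d then 1 else 0

-- total (δ u) counts the visits to u, so a walk is a Hamilton path if it is 1 for all vertices u.
δ : Word → Word → ℕ
δ u v = ⟦ u ≟ʷ v ⟧

δ₂ : Bool × Word → Bool × Word → ℕ
δ₂ (k , u) (l , v) = ⟦ (u ≟ʷ v) ×-dec (k Bool.≟ l) ⟧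

both-δ₂ : ∀ k u v → both (δ₂ (k , u)) v ≡ δ u v
both-δ₂ k u v with does (u ≟ʷ v)
both-δ₂ true  u v | true  = refl
both-δ₂ false u v | true  = refl
both-δ₂ k     u v | false = refl

δ-refl : ∀ u → δ u u ≡ 1
δ-refl u with u ≟ʷ u
... | yes _  = refl
... | no ne = ⊥-elim (ne refl)

ones zeros : ℕ → Word
ones n  = replicate n true
zeros n = replicate n false

odd : ℕ → ℕ
odd n = suc (n * 2)

first last : ℕ → ℕ → Word
first s t = ones t ++ zeros s
last  s t = zeros s ++ ones t

count-false-ones : ∀ n → count false (ones n) ≡ 0
count-false-ones zero    = refl
count-false-ones (suc n) = count-false-ones n

count-false-zeros : ∀ n → count false (zeros n) ≡ n
count-false-zeros zero    = refl
count-false-zeros (suc n) = cong suc (count-false-zeros n)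

count-true-ones : ∀ n → count true (ones n) ≡ n
count-true-ones zero    = refl
count-true-ones (suc n) = cong suc (count-true-ones n)

count-true-zeros : ∀ n → count true (zeros n) ≡ 0
count-true-zeros zero    = refl
count-true-zeros (suc n) = count-true-zeros n

count-++ : ∀ c u v → count c (u ++ v) ≡ count c u + count c v
count-++ c [] v = refl
count-++ true  (true ∷ u)  v = cong suc (count-++ true u v)
count-++ true  (false ∷ u) v = count-++ true u v
count-++ false (true ∷ u)  v = count-++ false u v
count-++ false (false ∷ u) v = cong suc (count-++ false u v)

count-false-first : ∀ s t → count false (first s t) ≡ s
count-false-first s t =
      trans (count-++ false (ones t) (zeros s)) (cong₂ _+_ (count-false-ones t) (count-false-zeros s))

count-true-first : ∀ s t → count true (first s t) ≡ t
count-true-first s t =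
      trans (count-++ true (ones t) (zeros s))
            (trans (cong₂ _+_ (count-true-ones t) (count-true-zeros s)) (+-identityʳ t))

count-false-last : ∀ s t → count false (last s t) ≡ s
count-false-last s t =
      trans (count-++ false (zeros s) (ones t))
            (trans (cong₂ _+_ (count-false-zeros s) (count-false-ones t)) (+-identityʳ s))

count-true-last : ∀ s t → count true (last s t) ≡ t
count-true-last s t =
      trans (count-++ true (zeros s) (ones t)) (cong₂ _+_ (count-true-zeros s) (count-true-ones t))

sgn-last : ∀ s t → sgn (last s t) ≡ false
sgn-last (suc s) t = sgn-last s t
sgn-last zero zero = refl
sgn-last zero (suc t) rewrite count-false-ones t = sgn-last zero t

-- Both leading ones contribute the number of zeros in `u`, and the two contributions cancel modulo
-- 2.
sgn-11 : ∀ u → sgn (true ∷ true ∷ u) ≡ sgn u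
sgn-11 u with parity (count false u)
... | true  = not-involutive (sgn u)
... | false = refl

parity-even : ∀ n → parity (n * 2) ≡ false
parity-even zero = refl
parity-even (suc n) rewrite parity-even n = refl

sgn-zeros : ∀ s → sgn (zeros s) ≡ false
sgn-zeros zero    = refl
sgn-zeros (suc s) = sgn-zeros s

-- The number of inversions is the product of the two counts, hence odd.
sgn-first : ∀ i j → sgn (first (odd i) (odd j)) ≡ true
sgn-first i zero rewrite count-false-zeros (i * 2) | parity-even i | sgn-zeros (i * 2) = refl
sgn-first i (suc j) = trans (sgn-11 (first (odd i) (odd j))) (sgn-first i j)

ones-unique : ∀ {n} u → count false u ≡ 0 → count true u ≡ n → u ≡ ones n
ones-unique []         _ refl = refl
ones-unique (true ∷ u) e refl = cong (true ∷_) (ones-unique u e refl)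

zeros-unique : ∀ {n} u → count true u ≡ 0 → count false u ≡ n → u ≡ zeros n
zeros-unique []          _ refl = refl
zeros-unique (false ∷ u) e refl = cong (false ∷_) (zeros-unique u e refl)

-- Used to splice a loop rooted at a neighbour `v` into a snake that ends at `u`.
link : ∀ {u v} → AdjSwap u v → Detour AdjSwap v → Detour AdjSwap u
link {u} r d b = (b , u) ∷⟨ rail r ⟩ d b ▹⟨ rail (swap-sym r) ⟩ [ not b , u ]

total-link : ∀ g {u v e} (r : AdjSwap u v) (d : Detour AdjSwap v) →
             (∀ b → total g (d b) ≡ e) → ∀ b → total g (link r d b) ≡ both g u + e
total-link g {u} {e = e} r d h b = begin
  g (b , u) + total g (d b ▹⟨ rail (swap-sym r) ⟩ [ not b , u ])
    ≡⟨ cong (g (b , u) +_) (total-▹ g (d b) [ not b , u ]) ⟩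
  g (b , u) + (total g (d b) + g (not b , u))
    ≡⟨ cong (λ n → g (b , u) + (n + g (not b , u))) (h b) ⟩
  g (b , u) + (e + g (not b , u))
    ≡⟨ cong (g (b , u) +_) (+-comm e _) ⟩
  g (b , u) + (g (not b , u) + e)
    ≡⟨ sym (+-assoc (g (b , u)) _ _) ⟩
  g (b , u) + g (not b , u) + e
    ≡⟨ cong (_+ e) (both-either g b u) ⟩
  both g u + e ∎
  where open ≡-Reasoning

there₂ : ∀ {c d u v} → AdjSwap u v → AdjSwap (c ∷ d ∷ u) (c ∷ d ∷ v)
there₂ r = there (there r)

prism-there₂ : ∀ {c d x y} → Prism AdjSwap x y →
               Prism AdjSwap (proj₁ x , c ∷ d ∷ proj₂ x) (proj₁ y , c ∷ d ∷ proj₂ y)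
prism-there₂ (rail r) = rail (there₂ r)
prism-there₂ rung     = rung

push : ∀ c d → Bool × Word → Bool × Word
push c d (k , u) = k , c ∷ d ∷ u

lift : ∀ c d {u} → Detour AdjSwap u → Detour AdjSwap (c ∷ d ∷ u)
lift c d D b = map (push c d) prism-there₂ (D b)

-- A pair of letters encodes the Boolean coordinate of the prism.
unfold : Bool × Word → Word
unfold (b , u) = b ∷ not b ∷ u

unfold-swap : ∀ {x y} → Prism AdjSwap x y → AdjSwap (unfold x) (unfold y)
unfold-swap (rail r)               = there₂ r
unfold-swap (rung {true}  {u})     = swap10
unfold-swap (rung {false} {u})     = swap01

-- A Gray code for odd letter counts

-- With a single zero the graph is itself a path, along which the zero moves from the right end to
-- the left end.
line₀ : ∀ t → Walk AdjSwap (first 1 t) (last 1 t)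
line₀ zero    = [ false ∷ [] ]
line₀ (suc t) = map (true ∷_) there (line₀ t) ▹⟨ swap10 ⟩ [ last 1 (suc t) ]

line₁ : ∀ s → Walk AdjSwap (first s 1) (last s 1)
line₁ zero    = [ true ∷ [] ]
line₁ (suc s) = first (suc s) 1 ∷⟨ swap10 ⟩ map (false ∷_) there (line₁ s)

-- The places where the loops are cut open. With 00 in front, `root₁ i j` is adjacent to the end of
-- `gray01 i j`; with 11 in front, `root₀ i j` is adjacent to the end of `yarg10 i j`. One level up,
-- the roots are the starts of `yarg10` and `gray01`.
root₁ root₀ : ℕ → ℕ → Word
root₁ i j = true  ∷ last  (i * 2) (odd j)
root₀ i j = false ∷ first (odd i) (j * 2)

ends-sgn : ∀ i j → sgn (last (odd i) (odd j)) ≡ not (sgn (first (odd i) (odd j)))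
ends-sgn i j = trans (sgn-last (odd i) (odd j)) (sym (cong not (sgn-first i j)))

-- Words starting with 11 or 00 are covered recursively. Those starting with a mixed pair form a
-- prism over the words with even numbers p of zeros and q of ones; splitting off two more letters, it
-- consists of two smaller prisms, covered by loop₁ and loop₀, and of K₂ × K₂ × the graph of words
-- with p - 1 zeros and q - 1 ones. A loop is a Hamilton cycle of a prism, cut open at the rung over
-- its root, so that it can be spliced in where a walk through the third part takes an adjacent rung.
gray  : ∀ i j → Walk AdjSwap (first (odd i) (odd j)) (last (odd i) (odd j))
loop₁ : ∀ i j → Detour AdjSwap (root₁ i j)
loop₀ : ∀ i j → Detour AdjSwap (root₀ i j)

gray01 : ∀ i j → Walk AdjSwap (false ∷ true ∷ first (odd i) (odd j)) (false ∷ true ∷ last (odd i) (odd j))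
gray01 i j = map (λ u → false ∷ true ∷ u) there₂ (gray i j)

gray10 : ∀ i j → Walk AdjSwap (true ∷ false ∷ first (odd i) (odd j)) (true ∷ false ∷ last (odd i) (odd j))
gray10 i j = map (λ u → true ∷ false ∷ u) there₂ (gray i j)

yarg10 : ∀ i j → Walk AdjSwap (true ∷ false ∷ last (odd i) (odd j)) (true ∷ false ∷ first (odd i) (odd j))
yarg10 i j = map (λ u → true ∷ false ∷ u) there₂ (reverse swap-sym (gray i j))

even01 : ∀ i j → EvenLength (gray01 i j)
even01 i j b = trans (tip-map (gray i j) b) (evenLength (gray i j) (ends-sgn i j) b)

even10 : ∀ i j → EvenLength (yarg10 i j)
even10 i j b = trans (tip-map (reverse swap-sym (gray i j)) b)
  (evenLength (reverse swap-sym (gray i j))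
    (trans (sym (not-involutive _)) (cong not (sym (ends-sgn i j)))) b)

detour00 : ∀ i j → Detour AdjSwap (false ∷ true ∷ last (odd i) (odd j))
detour00 i j = link (there swap10) (lift false false (loop₁ i j))

detour11 : ∀ i j → Detour AdjSwap (true ∷ false ∷ first (odd i) (odd j))
detour11 i j = link (there swap01) (lift true true (loop₀ i j))

loop₁ zero    j b = (b , root₁ 0 j) ∷⟨ rung ⟩ [ not b , root₁ 0 j ]
-- `root₁ (suc i) j` is 10 followed by `last (odd i) (odd j)`, where `yarg10` starts. The copy of it
-- that `openSnake` leaves out is visited at the very end.
loop₁ (suc i) j b =
  openSnake (yarg10 i j) (even10 i j) (detour11 i j) b
    ▹⟨ rail swap10 ⟩ fullSnake (gray01 i j) (even01 i j) (detour00 i j) (not b)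
    ▹⟨ rail swap01 ⟩ [ not b , root₁ (suc i) j ]

loop₀ i zero    b = (b , root₀ i 0) ∷⟨ rung ⟩ [ not b , root₀ i 0 ]
loop₀ i (suc j) b =
  openSnake (gray01 i j) (even01 i j) (detour00 i j) b
    ▹⟨ rail swap01 ⟩ fullSnake (yarg10 i j) (even10 i j) (detour11 i j) (not b)
    ▹⟨ rail swap10 ⟩ [ not b , root₀ i (suc j) ]

row : ∀ {u v} b → Walk AdjSwap u v → Walk (Prism AdjSwap) (b , u) (b , v)
row b p = map (b ,_) rail p

total-row : ∀ (g : Bool × Word → ℕ) {u v} b (p : Walk AdjSwap u v) →
      total g (row b p) ≡ total (λ u → g (b , u)) p
total-row g b p = total-map g p

-- The ends unfold to 1010.. and 0101.., the neighbours of the end of the 11-part and of the start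
-- of the 00-part in `gray`. Since the level has to change in between, the words with 10 are
-- traversed in two separate rows, and the loop over 11 carries the walk from one level to the
-- other.
middle : ∀ i j → Walk (Prism AdjSwap) (true  , true ∷ false ∷ last (odd i) (odd j))
                                      (false , false ∷ true ∷ first (odd i) (odd j))
middle i j =
  row true (yarg10 i j)
    ▹⟨ rail (there swap01) ⟩ lift true true (loop₀ i j) true
    ▹⟨ rail (there swap10) ⟩ row false (gray10 i j)
    ▹⟨ rail swap10 ⟩ reverse (prism-sym swap-sym)
                       (fullSnake (gray01 i j) (even01 i j) (detour00 i j) false)

gray zero    j       = line₀ (odd j)
gray (suc i) zero    = line₁ (odd (suc i))
gray (suc i) (suc j) =
  map (λ u → true ∷ true ∷ u) there₂ (gray (suc i) j)
    ▹⟨ there swap10 ⟩ map unfold unfold-swap (middle i j)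
    ▹⟨ there swap10 ⟩ map (λ u → false ∷ false ∷ u) there₂ (gray i (suc j))

-- Counting the visits of the Gray code

close : ∀ {A : Set} {R : A → A → Set} {g : A → ℕ} {x y z w v a b} (p : Walk R x y) {r : R y z}
      (q : Walk R z w) {s : R w v} →
        total g p + g v ≡ a → total g q ≡ b → total g (p ▹⟨ r ⟩ q ▹⟨ s ⟩ [ v ]) ≡ a + b
close {g = g} {v = v} p q refl refl = trans (total-▹ g p _)
  (trans (cong (total g p +_) (trans (total-▹ g q [ v ]) (+-comm (total g q) (g v))))
         (sym (+-assoc (total g p) (g v) _)))

module _ (g : Bool × Word → ℕ) where

  total-gray01 : ∀ i j → total (both g) (gray01 i j) ≡ total (λ u → both g (false ∷ true ∷ u)) (gray i j)
  total-gray01 i j = total-map (both g) (gray i j)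

  total-yarg10 : ∀ (h : Word → ℕ) i j → total h (yarg10 i j) ≡ total (λ u → h (true ∷ false ∷ u)) (gray i j)
  total-yarg10 h i j =
        trans (total-map h (reverse swap-sym (gray i j))) (total-reverse _ swap-sym (gray i j))

  module _ i j {m n} (h₁ : ∀ b → total (λ x → g (push false false x)) (loop₁ i j b) ≡ m)
                     (h₀ : ∀ b → total (λ x → g (push true true x)) (loop₀ i j b) ≡ n) where

    total-detour00 : ∀ b → total g (detour00 i j b) ≡ both g (false ∷ true ∷ last (odd i) (odd j)) + m
    total-detour00 = total-link g (there swap10) (lift false false (loop₁ i j))
      (λ b → trans (total-map g (loop₁ i j b)) (h₁ b))

    total-detour11 : ∀ b → total g (detour11 i j b) ≡ both g (true ∷ false ∷ first (odd i) (odd j)) + n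
    total-detour11 = total-link g (there swap01) (lift true true (loop₀ i j))
      (λ b → trans (total-map g (loop₀ i j b)) (h₀ b))

    private
      P01 = total (λ u → both g (false ∷ true ∷ u)) (gray i j)
      P10 = total (λ u → both g (true ∷ false ∷ u)) (gray i j)

    total-loop₁ : ∀ b → total g (loop₁ (suc i) j b) ≡ (P10 + n) + (P01 + m)
    total-loop₁ b = close
      (openSnake (yarg10 i j) (even10 i j) (detour11 i j) b)
      (fullSnake (gray01 i j) (even01 i j) (detour00 i j) (not b))
      (trans (total-openSnake g (yarg10 i j) (even10 i j) (detour11 i j) total-detour11 b)
             (cong (_+ n) (total-yarg10 (both g) i j)))
      (trans (total-fullSnake g (gray01 i j) (even01 i j) (detour00 i j) total-detour00 (not b))
             (cong (_+ m) (total-gray01 i j)))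

    total-loop₀ : ∀ b → total g (loop₀ i (suc j) b) ≡ (P01 + m) + (P10 + n)
    total-loop₀ b = close
      (openSnake (gray01 i j) (even01 i j) (detour00 i j) b)
      (fullSnake (yarg10 i j) (even10 i j) (detour11 i j) (not b))
      (trans (total-openSnake g (gray01 i j) (even01 i j) (detour00 i j) total-detour00 b)
             (cong (_+ m) (total-gray01 i j)))
      (trans (total-fullSnake g (yarg10 i j) (even10 i j) (detour11 i j) total-detour11 (not b))
             (cong (_+ n) (total-yarg10 (both g) i j)))

    total-middle : total g (middle i j) ≡
      total (λ u → g (true , true ∷ false ∷ u)) (gray i j)
        + (n + (total (λ u → g (false , true ∷ false ∷ u)) (gray i j) + (P01 + m)))
    total-middle =
      trans (total-▹ g (row true (yarg10 i j)) {r₁}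
            (lift true true (loop₀ i j) true ▹⟨ r₂ ⟩ row false (gray10 i j) ▹⟨ r₃ ⟩ back))
        (cong₂ _+_ (trans (total-row g true (yarg10 i j)) (total-yarg10 (λ u → g (true , u)) i j))
      (trans (total-▹ g (lift true true (loop₀ i j) true) {r₂} (row false (gray10 i j) ▹⟨ r₃ ⟩ back))
        (cong₂ _+_ (trans (total-map g (loop₀ i j true)) (h₀ true))
      (trans (total-▹ g (row false (gray10 i j)) {r₃} back)
        (cong₂ _+_ (trans (total-row g false (gray10 i j)) (total-map (λ u → g (false , u)) (gray i j)))
      (trans (total-reverse g (prism-sym swap-sym) snake01)
      (trans (total-fullSnake g (gray01 i j) (even01 i j) (detour00 i j) total-detour00 false)
             (cong (_+ m) (total-gray01 i j)))))))))
      where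
      snake01 = fullSnake (gray01 i j) (even01 i j) (detour00 i j) false
      back    = reverse (prism-sym swap-sym) snake01
      r₁ : Prism AdjSwap (true , true ∷ false ∷ first (odd i) (odd j)) (true , true ∷ true ∷ root₀ i j)
      r₁ = rail (there swap01)
      r₂ : Prism AdjSwap (false , true ∷ true ∷ root₀ i j) (false , true ∷ false ∷ first (odd i) (odd j))
      r₂ = rail (there swap10)
      r₃ : Prism AdjSwap (false , true ∷ false ∷ last (odd i) (odd j))
            (false , false ∷ true ∷ last (odd i) (odd j))
      r₃ = rail swap10

total-gray : ∀ (h : Word → ℕ) i j → total h (gray (suc i) (suc j)) ≡
  total (λ u → h (true ∷ true ∷ u)) (gray (suc i) j)
    + (total (λ x → h (unfold x)) (middle i j) + total (λ u → h (false ∷ false ∷ u)) (gray i (suc j)))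
total-gray h i j =
  trans (total-▹ h (map (λ u → true ∷ true ∷ u) there₂ (gray (suc i) j)) _) (cong₂ _+_
    (total-map h (gray (suc i) j))
    (trans (total-▹ h (map unfold unfold-swap (middle i j)) _) (cong₂ _+_
      (total-map h (middle i j))
      (total-map h (gray i (suc j))))))

line₀-covers : ∀ t u → count false u ≡ 1 → count true u ≡ t → total (δ u) (line₀ t) ≡ 1
line₀-covers zero    (false ∷ [])        _ _ = refl
line₀-covers zero    (false ∷ false ∷ u) () _
line₀-covers zero    (false ∷ true ∷ u)  _ ()
line₀-covers (suc t) (true ∷ u)  e f =
  trans (total-▹ (δ (true ∷ u)) (map (true ∷_) there (line₀ t)) [ last 1 (suc t) ])
    (trans (+-identityʳ _) (trans (total-map (δ (true ∷ u)) (line₀ t))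
      (line₀-covers t u e (suc-injective f))))
line₀-covers (suc t) (false ∷ u) e f with refl ← ones-unique u (suc-injective e) f =
  trans (total-▹ (δ (last 1 (suc t))) (map (true ∷_) there (line₀ t)) [ last 1 (suc t) ])
    (cong₂ _+_ (trans (total-map (δ (last 1 (suc t))) (line₀ t)) (total-0 (line₀ t)))
               (δ-refl (last 1 (suc t))))

line₁-covers : ∀ s u → count false u ≡ s → count true u ≡ 1 → total (δ u) (line₁ s) ≡ 1
line₁-covers zero    (true ∷ [])        _ _ = refl
line₁-covers zero    (true ∷ true ∷ u)  _ ()
line₁-covers zero    (true ∷ false ∷ u) () _
line₁-covers (suc s) (false ∷ u) e f =
  trans (total-map (δ (false ∷ u)) (line₁ s)) (line₁-covers s u (suc-injective e) f)
line₁-covers (suc s) (true ∷ u) e f with refl ← zeros-unique u (suc-injective f) e =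
  cong₂ _+_ (δ-refl (first (suc s) 1))
            (trans (total-map (δ (first (suc s) 1)) (line₁ s)) (total-0 (line₁ s)))

δ₂-rung : ∀ k u b → δ₂ (k , u) (b , u) + δ₂ (k , u) (not b , u) ≡ 1
δ₂-rung k u b = trans (both-either (δ₂ (k , u)) b u) (trans (both-δ₂ k u u) (δ-refl u))

gray-covers : ∀ i j u → count false u ≡ odd i → count true u ≡ odd j → total (δ u) (gray i j) ≡ 1
loop₁-covers : ∀ i j k u → count false u ≡ i * 2 → count true u ≡ suc (odd j) →
               ∀ b → total (δ₂ (k , u)) (loop₁ i j b) ≡ 1
loop₀-covers : ∀ i j k u → count false u ≡ suc (odd i) → count true u ≡ j * 2 →
               ∀ b → total (δ₂ (k , u)) (loop₀ i j b) ≡ 1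
gray-both : ∀ i j k u → count false u ≡ odd i → count true u ≡ odd j →
      total (both (δ₂ (k , u))) (gray i j) ≡ 1

gray-both i j k u e f = trans (total-cong (both-δ₂ k u) (gray i j)) (gray-covers i j u e f)

loop₁-covers zero j k u e f b with refl ← ones-unique u e f =
  δ₂-rung k (ones (suc (odd j))) b
loop₁-covers (suc i) j k [] e () b
loop₁-covers (suc i) j k (true ∷ []) () f b
loop₁-covers (suc i) j k (false ∷ []) () f b
-- The first two letters of `w` decide which piece visits it. On the other pieces the indicator
-- computes to 0, so that `total-0` applies to them.
loop₁-covers (suc i) j k w@(true ∷ true ∷ u) e f b =
  trans (total-loop₁ (δ₂ (k , w)) i j {n =
        1} (λ b → total-0 (loop₁ i j b)) (loop₀-covers i j k u e (suc-injective (suc-injective f))) b)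
    (cong₂ _+_ (cong (_+ 1) (total-0 (gray i j))) (cong (_+ 0) (total-0 (gray i j))))
loop₁-covers (suc i) j k w@(false ∷ false ∷ u) e f b =
  trans (total-loop₁ (δ₂ (k , w)) i j {m =
        1} (loop₁-covers i j k u (suc-injective (suc-injective e)) f) (λ b → total-0 (loop₀ i j b)) b)
    (cong₂ _+_ (cong (_+ 0) (total-0 (gray i j))) (cong (_+ 1) (total-0 (gray i j))))
loop₁-covers (suc i) j k w@(true ∷ false ∷ u) e f b =
  trans (total-loop₁ (δ₂ (k , w)) i j (λ b → total-0 (loop₁ i j b)) (λ b → total-0 (loop₀ i j b)) b)
    (cong₂ _+_ (cong (_+ 0) (gray-both i j k u (suc-injective e) (suc-injective f)))
          (cong (_+ 0) (total-0 (gray i j))))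
loop₁-covers (suc i) j k w@(false ∷ true ∷ u) e f b =
  trans (total-loop₁ (δ₂ (k , w)) i j (λ b → total-0 (loop₁ i j b)) (λ b → total-0 (loop₀ i j b)) b)
    (cong₂ _+_ (cong (_+ 0) (total-0 (gray i j)))
          (cong (_+ 0) (gray-both i j k u (suc-injective e) (suc-injective f))))

loop₀-covers i zero k u e f b with refl ← zeros-unique u f e =
  δ₂-rung k (zeros (suc (odd i))) b
loop₀-covers i (suc j) k [] () f b
loop₀-covers i (suc j) k (true ∷ []) () f b
loop₀-covers i (suc j) k (false ∷ []) e () b
loop₀-covers i (suc j) k w@(true ∷ true ∷ u) e f b =
  trans (total-loop₀ (δ₂ (k , w)) i j {n =
        1} (λ b → total-0 (loop₁ i j b)) (loop₀-covers i j k u e (suc-injective (suc-injective f))) b)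
    (cong₂ _+_ (cong (_+ 0) (total-0 (gray i j))) (cong (_+ 1) (total-0 (gray i j))))
loop₀-covers i (suc j) k w@(false ∷ false ∷ u) e f b =
  trans (total-loop₀ (δ₂ (k , w)) i j {m =
        1} (loop₁-covers i j k u (suc-injective (suc-injective e)) f) (λ b → total-0 (loop₀ i j b)) b)
    (cong₂ _+_ (cong (_+ 1) (total-0 (gray i j))) (cong (_+ 0) (total-0 (gray i j))))
loop₀-covers i (suc j) k w@(true ∷ false ∷ u) e f b =
  trans (total-loop₀ (δ₂ (k , w)) i j (λ b → total-0 (loop₁ i j b)) (λ b → total-0 (loop₀ i j b)) b)
    (cong₂ _+_ (cong (_+ 0) (total-0 (gray i j)))
          (cong (_+ 0) (gray-both i j k u (suc-injective e) (suc-injective f))))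
loop₀-covers i (suc j) k w@(false ∷ true ∷ u) e f b =
  trans (total-loop₀ (δ₂ (k , w)) i j (λ b → total-0 (loop₁ i j b)) (λ b → total-0 (loop₀ i j b)) b)
    (cong₂ _+_ (cong (_+ 0) (gray-both i j k u (suc-injective e) (suc-injective f)))
          (cong (_+ 0) (total-0 (gray i j))))

middle-covers : ∀ i j k u → count false u ≡ suc (odd i) → count true u ≡ suc (odd j) →
                total (δ₂ (k , u)) (middle i j) ≡ 1
middle-covers i j k [] () f
middle-covers i j k (true ∷ []) () f
middle-covers i j k (false ∷ []) e ()
middle-covers i j k w@(true ∷ true ∷ u) e f =
  trans (total-middle (δ₂ (k , w)) i j {n =
        1} (λ b → total-0 (loop₁ i j b)) (loop₀-covers i j k u e (suc-injective (suc-injective f))))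
    (cong₂ (λ x y → x + (1 + (x + (y + 0)))) (total-0 (gray i j)) (total-0 (gray i j)))
middle-covers i j k w@(false ∷ false ∷ u) e f =
  trans (total-middle (δ₂ (k , w)) i j {m =
        1} (loop₁-covers i j k u (suc-injective (suc-injective e)) f) (λ b → total-0 (loop₀ i j b)))
    (cong₂ (λ x y → x + (0 + (x + (y + 1)))) (total-0 (gray i j)) (total-0 (gray i j)))
middle-covers i j k w@(false ∷ true ∷ u) e f =
  trans (total-middle (δ₂ (k , w)) i j (λ b → total-0 (loop₁ i j b)) (λ b → total-0 (loop₀ i j b)))
    (cong₂ (λ x y → x + (0 + (x + (y + 0)))) (total-0 (gray i j))
          (gray-both i j k u (suc-injective e) (suc-injective f)))
middle-covers i j k w@(true ∷ false ∷ u) e f =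
  trans (total-middle (δ₂ (k , w)) i j (λ b → total-0 (loop₁ i j b)) (λ b → total-0 (loop₀ i j b)))
    -- The words with 10 are visited in two rows, one per level; only the two counts together amount
    -- to the sum of `both`.
    (trans (cong (at true +_) (trans (cong (λ y → at false + (y + 0)) (total-0 (gray i j)))
          (+-identityʳ (at false))))
      (trans (total-+ _ _ (gray i j)) (gray-both i j k u (suc-injective e) (suc-injective f))))
  where at : Bool → ℕ
        at b = total (λ v → δ₂ (k , u) (b , v)) (gray i j)

δ-unfold : ∀ c u x → δ (unfold (c , u)) (unfold x) ≡ δ₂ (c , u) x
δ-unfold true  u (true  , v) with does (u ≟ʷ v)
... | true  = refl
... | false = refl
δ-unfold true  u (false , v) with does (u ≟ʷ v)
... | true  = refl
... | false = refl
δ-unfold false u (true  , v) with does (u ≟ʷ v)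
... | true  = refl
... | false = refl
δ-unfold false u (false , v) with does (u ≟ʷ v)
... | true  = refl
... | false = refl

δ-unequal-unfold : ∀ c u x → δ (c ∷ c ∷ u) (unfold x) ≡ 0
δ-unequal-unfold true  u (true  , v) = refl
δ-unequal-unfold true  u (false , v) = refl
δ-unequal-unfold false u (true  , v) = refl
δ-unequal-unfold false u (false , v) = refl

total-unequal : ∀ c u i j → total (λ x → δ (c ∷ c ∷ u) (unfold x)) (middle i j) ≡ 0
total-unequal c u i j = trans (total-cong (δ-unequal-unfold c u) (middle i j)) (total-0 (middle i j))

gray-covers zero    j       u e f = line₀-covers (odd j) u e f
gray-covers (suc i) zero    u e f = line₁-covers (odd (suc i)) u e f
gray-covers (suc i) (suc j) [] () f
gray-covers (suc i) (suc j) (true ∷ []) () f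
gray-covers (suc i) (suc j) (false ∷ []) e ()
gray-covers (suc i) (suc j) w@(true ∷ true ∷ u) e f =
  trans (total-gray (δ w) i j)
    (cong₂ _+_ (gray-covers (suc i) j u e (suc-injective (suc-injective f)))
      (cong₂ _+_ (total-unequal true u i j) (total-0 (gray i (suc j)))))
gray-covers (suc i) (suc j) w@(false ∷ false ∷ u) e f =
  trans (total-gray (δ w) i j)
    (cong₂ _+_ (total-0 (gray (suc i) j))
      (cong₂ _+_ (total-unequal false u i j) (gray-covers i (suc j) u (suc-injective (suc-injective e)) f)))
gray-covers (suc i) (suc j) w@(true ∷ false ∷ u) e f =
  trans (total-gray (δ w) i j)
    (cong₂ _+_ (total-0 (gray (suc i) j))
      (cong₂ _+_ (trans (total-cong (δ-unfold true u) (middle i j))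
            (middle-covers i j true u (suc-injective e) (suc-injective f)))
                 (total-0 (gray i (suc j)))))
gray-covers (suc i) (suc j) w@(false ∷ true ∷ u) e f =
  trans (total-gray (δ w) i j)
    (cong₂ _+_ (total-0 (gray (suc i) j))
      (cong₂ _+_ (trans (total-cong (δ-unfold false u) (middle i j))
            (middle-covers i j false u (suc-injective e) (suc-injective f)))
                 (total-0 (gray i (suc j)))))

-- Hamilton paths and cycles of the graph of combinations

count-length : ∀ w → count false w + count true w ≡ length w
count-length []          = refl
count-length (false ∷ w) = cong suc (count-length w)
count-length (true ∷ w)  = trans (+-suc (count false w) _) (cong suc (count-length w))

module _ {s t : ℕ} where

  Vertex : Set
  Vertex = V (Comb s t)

  vertex : ∀ w → count false w ≡ s → count true w ≡ t → Vertex
  vertex w e f = w , trans (sym (count-length w)) (cong₂ _+_ e f) , e , f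

  vertex-≡ : ∀ {u v : Vertex} → proj₁ u ≡ proj₁ v → u ≡ v
  vertex-≡ {u , l , e , f} {.u , l′ , e′ , f′} refl
    rewrite ≡-irrelevant l l′ | ≡-irrelevant e e′ | ≡-irrelevant f f′ = refl

  step : ∀ {u v} → AdjSwap u v → count false u ≡ s × count true u ≡ t → count false v ≡ s × count true v ≡ t
  step r (e , f) = trans (sym (count-swap false r)) e , trans (sym (count-swap true r)) f

  vertices : ∀ {u v} → Walk AdjSwap u v → count false u ≡ s × count true u ≡ t → List Vertex
  vertices [ u ]         (e , f) = vertex u e f ∷ []
  vertices (u ∷⟨ r ⟩ p) (e , f) = vertex u e f ∷ vertices p (step r (e , f))

  vertices-linked : ∀ {u v} (p : Walk AdjSwap u v) h → Linked (Adj (Comb s t)) (vertices p h)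
  vertices-linked [ u ]                     h = [-]
  vertices-linked (u ∷⟨ r ⟩ [ v ])         h = r ∷ [-]
  vertices-linked (u ∷⟨ r ⟩ p@(_ ∷⟨ _ ⟩ _)) h = r ∷ vertices-linked p (step r h)

  vertices-∉ : ∀ {u v} (p : Walk AdjSwap u v) h (w : Vertex) → total (δ (proj₁ w)) p ≡ 0 →
        All (w ≢_) (vertices p h)
  vertices-∉ [ u ]         h w z with proj₁ w ≟ʷ u
  ... | no ne = (ne ∘ cong proj₁) ∷ []
  vertices-∉ (u ∷⟨ r ⟩ p) h w z with proj₁ w ≟ʷ u
  ... | no ne = (ne ∘ cong proj₁) ∷ vertices-∉ p (step r h) w z

  vertices-∈ : ∀ {u v} (p : Walk AdjSwap u v) h (w : Vertex) → total (δ (proj₁ w)) p ≡ 1 → w ∈ vertices p h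
  vertices-∈ [ u ]         h w z with proj₁ w ≟ʷ u
  ... | yes e = here (vertex-≡ e)
  vertices-∈ (u ∷⟨ r ⟩ p) h w z with proj₁ w ≟ʷ u
  ... | yes e = here (vertex-≡ e)
  ... | no ne = there (vertices-∈ p (step r h) w z)

  vertices-unique : ∀ {u v} (p : Walk AdjSwap u v) h →
                    (∀ (w : Vertex) → total (δ (proj₁ w)) p ≤ 1) → Unique (vertices p h)
  vertices-unique [ u ]         h le = [] ∷ []
  vertices-unique (u ∷⟨ r ⟩ p) h le =
    vertices-∉ p (step r h) _ (n≤0⇒n≡0 (drop (le (vertex u (proj₁ h) (proj₂ h)))))
    ∷ vertices-unique p (step r h) (λ w → ≤-trans (m≤n+m _ (δ (proj₁ w) u)) (le w))
    where
    drop : ∀ {n} → δ u u + n ≤ 1 → n ≤ 0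
    drop l rewrite δ-refl u with s≤s l′ ← l = l′

  walk-HamiltonPath : ∀ {u v} (p : Walk AdjSwap u v) → count false u ≡ s → count true u ≡ t →
    (∀ w → count false w ≡ s → count true w ≡ t → total (δ w) p ≡ 1) → HamiltonPath (Comb s t)
  walk-HamiltonPath p e f covers =
    vertices p (e , f) ,
    vertices-unique p (e , f) (λ (w , _ , e , f) → ≤-reflexive (covers w e f)) ,
    (λ (w , l , e′ , f′) → vertices-∈ p (e , f) _ (covers w e′ f′)) ,
    vertices-linked p (e , f)

Condition : ℕ → ℕ → Set
Condition a b = a ≡ 1 ⊎ a ≡ 2 ⊎ b ≡ 1 ⊎ b ≡ 2 ⊎ (2 ∣ a × 2 ∣ b)

Comb-path : ∀ a b → 1 ≤ a → 1 ≤ b → Condition a b → HamiltonPath (Comb (a ∸ 1) (b ∸ 1))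
Comb-path .1 (suc t) _ _ (inj₁ refl) =
  walk-HamiltonPath [ ones t ] (count-false-ones t) (count-true-ones t)
    λ w e f → trans (cong (δ w) (sym (ones-unique w e f))) (δ-refl w)
Comb-path .2 (suc t) _ _ (inj₂ (inj₁ refl)) =
  walk-HamiltonPath (line₀ t) (count-false-first 1 t) (count-true-first 1 t) (line₀-covers t)
Comb-path (suc s) .1 _ _ (inj₂ (inj₂ (inj₁ refl))) =
  walk-HamiltonPath [ zeros s ] (count-false-zeros s) (count-true-zeros s)
    λ w e f → trans (cong (δ w) (sym (zeros-unique w f e))) (δ-refl w)
Comb-path (suc s) .2 _ _ (inj₂ (inj₂ (inj₂ (inj₁ refl)))) =
  walk-HamiltonPath (line₁ s) (count-false-first s 1) (count-true-first s 1) (line₁-covers s)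
Comb-path _ _ () _ (inj₂ (inj₂ (inj₂ (inj₂ (divides zero refl , _)))))
Comb-path _ _ _ () (inj₂ (inj₂ (inj₂ (inj₂ (divides (suc i) refl , divides zero refl)))))
-- For `a` equal to `suc i * 2`, the count `a ∸ 1` reduces to `odd i`, and likewise for `b`.
Comb-path _ _ _ _ (inj₂ (inj₂ (inj₂ (inj₂ (divides (suc i) refl , divides (suc j) refl))))) =
  walk-HamiltonPath (gray i j) (count-false-first (odd i) (odd j)) (count-true-first (odd i) (odd j))
        (gray-covers i j)

-- Swaps the first unequal pair among the letters 1 and 2, 3 and 4, ...: a sign-reversing involution
-- on the words it does not fix.
σ : Word → Word
σ []                  = []
σ (x ∷ [])            = x ∷ []
σ (true  ∷ true  ∷ w) = true  ∷ true  ∷ σ w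
σ (false ∷ false ∷ w) = false ∷ false ∷ σ w
σ (true  ∷ false ∷ w) = false ∷ true  ∷ w
σ (false ∷ true  ∷ w) = true  ∷ false ∷ w

σ-involutive : ∀ w → σ (σ w) ≡ w
σ-involutive []                  = refl
σ-involutive (x ∷ [])            = refl
σ-involutive (true  ∷ true  ∷ w) = cong (λ u → true ∷ true ∷ u) (σ-involutive w)
σ-involutive (false ∷ false ∷ w) = cong (λ u → false ∷ false ∷ u) (σ-involutive w)
σ-involutive (true  ∷ false ∷ w) = refl
σ-involutive (false ∷ true  ∷ w) = refl

-- A leading pair 00 or 11 does not affect the parity of inversions, so an odd word must contain a
-- mixed pair, on which `σ` acts as an adjacent swap.
σ-swap : ∀ w → sgn w ≡ true → AdjSwap w (σ w)
σ-swap []                  ()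
σ-swap (true ∷ [])         ()
σ-swap (false ∷ [])        ()
σ-swap (true  ∷ true  ∷ w) e = there (there (σ-swap w (trans (sym (sgn-11 w)) e)))
σ-swap (false ∷ false ∷ w) e = there (there (σ-swap w e))
σ-swap (true  ∷ false ∷ w) e = swap10
σ-swap (false ∷ true  ∷ w) e = swap01

parity-suc² : ∀ n → parity (suc (suc n)) ≡ parity n
parity-suc² n = not-involutive (parity n)

-- Pairs 00 and 11 followed by at most one letter form a word fixed by `σ`; the extra letter makes
-- up for one odd count, but not for two.
fixed-word : ∀ s t → parity s ∧ parity t ≡ false →
             Σ Word λ w → count false w ≡ s × count true w ≡ t × σ w ≡ w
fixed-word (suc (suc s)) t e =
  let w , f , g , h = fixed-word s t (trans (cong (_∧ parity t) (sym (parity-suc² s))) e)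
  in false ∷ false ∷ w , cong (suc ∘ suc) f , g , cong (λ u → false ∷ false ∷ u) h
fixed-word zero       zero          e = [] , refl , refl , refl
fixed-word zero       (suc zero)    e = true ∷ [] , refl , refl , refl
fixed-word zero       (suc (suc t)) e =
  let w , f , g , h = fixed-word zero t refl
  in true ∷ true ∷ w , f , cong (suc ∘ suc) g , cong (λ u → true ∷ true ∷ u) h
fixed-word (suc zero) zero          e = false ∷ [] , refl , refl , refl
fixed-word (suc zero) (suc zero)    ()
fixed-word (suc zero) (suc (suc t)) e =
  let w , f , g , h = fixed-word 1 t (trans (sym (parity-suc² t)) e)
  in true ∷ true ∷ w , f , cong (suc ∘ suc) g , cong (λ u → true ∷ true ∷ u) h

fixed-even : ∀ w → σ w ≡ w → sgn w ≡ false
fixed-even w e with sgn w in eq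
... | false = refl
... | true  with () ← trans (sym eq)
      (trans (cong sgn (sym e)) (trans (sgn-swap (σ-swap w eq)) (cong not eq)))

unique-⊆-length : ∀ {A : Set} {xs ys : List A} → Unique xs → (∀ {x} → x ∈ xs → x ∈ ys) →
      length xs ≤ length ys
unique-⊆-length []             sub = z≤n
unique-⊆-length {xs = x ∷ xs} (x∉ ∷ u) sub with ∈-∃++ (sub (here refl))
... | ys₁ , ys₂ , refl = ≤-trans (s≤s (unique-⊆-length u sub′)) (≤-reflexive (sym eq))
  where
  eq : length (ys₁ ++ x ∷ ys₂) ≡ suc (length (ys₁ ++ ys₂))
  eq = trans (length-++ ys₁) (trans (+-suc (length ys₁) _) (cong suc (sym (length-++ ys₁))))
  sub′ : ∀ {z} → z ∈ xs → z ∈ ys₁ ++ ys₂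
  sub′ z∈ with ∈-++⁻ ys₁ (sub (there z∈))
  ... | inj₁ p            = ∈-++⁺ˡ p
  ... | inj₂ (here refl)  = ⊥-elim (All.lookup x∉ z∈ refl)
  ... | inj₂ (there p)    = ∈-++⁺ʳ ys₁ p

ofSign : Bool → List Word → List Word
ofSign b = filter (λ w → sgn w Bool.≟ b)

-- The head of `ws` has the sign opposite to that of `w`, and signs alternate from there on, so the
-- opposite sign leads by 0 or 1.
alternating : ∀ {w ws} → Linked AdjSwap (w ∷ ws) →
  length (ofSign (sgn w) ws) ≤ length (ofSign (not (sgn w)) ws) ×
  length (ofSign (not (sgn w)) ws) ≤ suc (length (ofSign (sgn w) ws))
alternating [-] = z≤n , z≤n
alternating {w} {v ∷ ws} (r ∷ l) with sgn w | sgn v | sgn-swap r | alternating l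
... | true  | .false | refl | lo , hi = hi , s≤s lo
... | false | .true  | refl | lo , hi = hi , s≤s lo

even≤1+odd : ∀ {ws} → Linked AdjSwap ws → length (ofSign false ws) ≤ suc (length (ofSign true ws))
even≤1+odd []  = z≤n
even≤1+odd {w ∷ ws} l with sgn w in eq | alternating l
... | true  | lo , hi = ≤-trans hi (m≤n+m _ 1)
... | false | lo , hi = s≤s lo

Comb-no-path : ∀ s t → parity (suc (suc s)) ∧ parity (suc (suc t)) ≡ false →
               ¬ HamiltonPath (Comb (suc (suc s)) (suc (suc t)))
Comb-no-path s t pf (vs , unique , complete , linked) =
  -- With n odd words on the path, 2 + n ≤ number of even words ≤ 1 + n.
  1+n≰n (≤-trans (≤-trans (≤-reflexive (cong (suc ∘ suc) (sym (length-map σ odds))))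
        (unique-⊆-length unique′ sub))
                 (even≤1+odd ws-linked))
  where
  ws odds evens : List Word
  ws    = List.map proj₁ vs
  odds  = ofSign true ws
  evens = ofSign false ws

  ws-linked : Linked AdjSwap ws
  ws-linked = Linked.map⁺ linked

  ws-unique : Unique ws
  ws-unique = Unique.map⁺ vertex-≡ unique

  ∈-ws : ∀ w → count false w ≡ suc (suc s) → count true w ≡ suc (suc t) → w ∈ ws
  ∈-ws w e f = ∈-map⁺ proj₁ (complete (vertex w e f))

  -- One fixed word with two letters of each kind removed yields two distinct fixed words, by
  -- putting 0011 or 1100 in front.
  core = fixed-word s t (trans (sym (cong₂ _∧_ (parity-suc² s) (parity-suc² t))) pf)
  w₀ f₁ f₂ : Word
  w₀ = proj₁ core
  f₁ = false ∷ false ∷ true ∷ true ∷ w₀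
  f₂ = true ∷ true ∷ false ∷ false ∷ w₀

  f₁-fixed : σ f₁ ≡ f₁
  f₁-fixed = cong (λ u → false ∷ false ∷ true ∷ true ∷ u) (proj₂ (proj₂ (proj₂ core)))

  f₂-fixed : σ f₂ ≡ f₂
  f₂-fixed = cong (λ u → true ∷ true ∷ false ∷ false ∷ u) (proj₂ (proj₂ (proj₂ core)))

  f₁∈ : f₁ ∈ ws
  f₁∈ = ∈-ws f₁ (cong (suc ∘ suc) (proj₁ (proj₂ core))) (cong (suc ∘ suc) (proj₁ (proj₂ (proj₂ core))))

  f₂∈ : f₂ ∈ ws
  f₂∈ = ∈-ws f₂ (cong (suc ∘ suc) (proj₁ (proj₂ core))) (cong (suc ∘ suc) (proj₁ (proj₂ (proj₂ core))))

  fixed∉ : ∀ f → σ f ≡ f → f ∉ List.map σ odds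
  fixed∉ f e f∈ with ∈-map⁻ σ f∈
  ... | w , w∈ , refl with ∈-filter⁻ (λ u → sgn u Bool.≟ true) {xs = ws} w∈
  ... | _ , sw with () ← trans (sym sw) (fixed-even w (sym (trans (sym (σ-involutive w)) e)))

  unique′ : Unique (f₁ ∷ f₂ ∷ List.map σ odds)
  unique′ = ((λ ()) ∷ ¬Any⇒All¬ _ (fixed∉ f₁ f₁-fixed)) ∷ ¬Any⇒All¬ _ (fixed∉ f₂ f₂-fixed)
          ∷ Unique.map⁺ (λ {x} {y} e → trans (sym (σ-involutive x)) (trans (cong σ e) (σ-involutive y)))
                        (Unique.filter⁺ (λ u → sgn u Bool.≟ true) ws-unique)

  even-∈ : ∀ {w} → w ∈ ws → sgn w ≡ false → w ∈ evens
  even-∈ = ∈-filter⁺ (λ u → sgn u Bool.≟ false)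

  sub : ∀ {w} → w ∈ f₁ ∷ f₂ ∷ List.map σ odds → w ∈ evens
  sub (here refl)         = even-∈ f₁∈ (fixed-even f₁ f₁-fixed)
  sub (there (here refl)) = even-∈ f₂∈ (fixed-even f₂ f₂-fixed)
  sub (there (there p)) with ∈-map⁻ σ p
  ... | w , w∈ , refl with ∈-filter⁻ (λ u → sgn u Bool.≟ true) {xs = ws} w∈
  ... | w∈ws , sw with ∈-map⁻ proj₁ w∈ws
  ... | (_ , _ , e , f) , _ , refl =
    even-∈ (∈-ws (σ w) (trans (sym (count-swap false r)) e) (trans (sym (count-swap true r)) f))
           (trans (sgn-swap r) (cong not sw))
    where r = σ-swap w sw

odd⇒2∣ : ∀ n → parity n ≡ true → 2 ∣ suc n
odd⇒2∣ (suc zero)    e = divides 1 refl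
odd⇒2∣ (suc (suc n)) e with divides q eq ← odd⇒2∣ n (trans (sym (parity-suc² n)) e) =
      divides (suc q) (cong (suc ∘ suc) eq)

Comb-path-condition : ∀ a b → 1 ≤ a → 1 ≤ b → HamiltonPath (Comb (a ∸ 1) (b ∸ 1)) → Condition a b
Comb-path-condition 1 b _ _ h = inj₁ refl
Comb-path-condition 2 b _ _ h = inj₂ (inj₁ refl)
Comb-path-condition a@(suc (suc (suc _))) 1 _ _ h = inj₂ (inj₂ (inj₁ refl))
Comb-path-condition a@(suc (suc (suc _))) 2 _ _ h = inj₂ (inj₂ (inj₂ (inj₁ refl)))
Comb-path-condition (suc (suc (suc s))) (suc (suc (suc t))) _ _ h
  with parity (suc (suc s)) in es | parity (suc (suc t)) in et
... | true  | true  = inj₂ (inj₂ (inj₂ (inj₂ (odd⇒2∣ _ es , odd⇒2∣ _ et))))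
... | true  | false = ⊥-elim (Comb-no-path s t (cong₂ _∧_ es et) h)
... | false | _     = ⊥-elim (Comb-no-path s t (cong (_∧ parity (suc (suc t))) es) h)

-- Neighbours on a Hamilton cycle

last-step : ∀ {A : Set} {R : A → A → Set} {q} x xs → Linked R ((x ∷ xs) ∷ʳ q) → ∃ λ y → y ∈ x ∷ xs × R y q
last-step x []       (r ∷ _) = x , here refl , r
last-step x (z ∷ xs) (_ ∷ l) = let y , y∈ , r = last-step z xs l in y , there y∈ , r

module _ {A : Set} {R : A → A → Set} where

  TwoNeighbours : A → Set
  TwoNeighbours w = ∃ λ x → ∃ λ y → R x w × R w y × x ≢ y

  -- Uniqueness separates predecessor and successor, except that `p` and `q` may coincide, as they
  -- do on a cycle; the disjunction then rules out a single inner vertex. Beyond the first inner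
  -- vertex the predecessor belongs to `xs` and so differs from `q`.
  inner-neighbours : ∀ {p q w} xs → Linked R (p ∷ xs ∷ʳ q) → Unique (p ∷ xs) → q ∉ xs →
                     p ≢ q ⊎ 2 ≤ length xs → w ∈ xs → TwoNeighbours w
  inner-neighbours (w ∷ [])     (r ∷ r′ ∷ _) u q∉ (inj₁ p≢q)      (here refl) = _ , _ , r , r′ , p≢q
  inner-neighbours (w ∷ [])     l            u q∉ (inj₂ (s≤s ())) (here refl)
  inner-neighbours (w ∷ z ∷ xs) (r ∷ r′ ∷ _) ((_ ∷ p≢z ∷ _) ∷ _) q∉ _ (here refl) = _ , _ , r , r′ , p≢z
  inner-neighbours (x ∷ xs)     (_ ∷ l)      (_ ∷ u) q∉ _ (there w∈) =
    inner-neighbours xs l u (q∉ ∘ there) (inj₁ (λ e → q∉ (here (sym e)))) w∈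

  cycle-neighbours : ∀ {v} rest → 3 ≤ length (v ∷ rest) → Unique (v ∷ rest) →
                     Linked R ((v ∷ rest) ∷ʳ v) → ∀ {w} → w ∈ v ∷ rest → TwoNeighbours w
  cycle-neighbours (x ∷ [])       (s≤s (s≤s ())) _ _ _
  cycle-neighbours (x ∷ y ∷ rest) _ (_ ∷ x∉ ∷ _) (r ∷ _ ∷ l) (here refl) =
    let z , z∈ , r′ = last-step y rest l
    in z , x , r′ , r , λ e → All.lookup x∉ z∈ (sym e)
  cycle-neighbours rest (s≤s 2≤) u@(v∉ ∷ _) l (there w∈) =
    inner-neighbours rest l u (All¬⇒¬Any v∉) (inj₂ 2≤) w∈

ones-isolated : ∀ t {u} → ¬ AdjSwap (ones t) u
ones-isolated (suc (suc t)) (here ne) = ne refl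
ones-isolated (suc t)       (there r) = ones-isolated t r

-- There is only one place where two adjacent letters differ.
last-leaf : ∀ s t {u} → AdjSwap (last (suc s) (suc t)) u → u ≡ zeros s ++ true ∷ false ∷ ones t
last-leaf zero    t (here _)  = refl
last-leaf zero    t (there r) = ⊥-elim (ones-isolated (suc t) r)
last-leaf (suc s) t (here ne) = ⊥-elim (ne refl)
last-leaf (suc s) t (there r) = cong (false ∷_) (last-leaf s t r)

Comb-no-cycle : ∀ s t → ¬ HamiltonCycle (Comb (suc s) (suc t))
Comb-no-cycle s t (v , rest , 3≤ , unique , complete , linked) =
  let leaf = vertex (last (suc s) (suc t)) (count-false-last (suc s) (suc t))
        (count-true-last (suc s) (suc t))
      x , y , r , r′ , x≢y = cycle-neighbours rest 3≤ unique linked (complete leaf)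
  in x≢y (vertex-≡ (trans (last-leaf s t (swap-sym r)) (sym (last-leaf s t r′))))

-- Transfer along isomorphisms

module _ {G H : Graph} where

  isomorphic-sym : Isomorphic G H → Isomorphic H G
  isomorphic-sym (f , adj) = record
    { to = from ; from = to ; to-cong = cong from ; from-cong = cong to
    ; inverse =
          (λ e → trans (cong from e) (strictlyInverseʳ _)) ,
                (λ e → trans (cong to e) (strictlyInverseˡ _)) } ,
    λ u v → (λ r → proj₂ (adj (from u) (from v))
          (subst₂ (Adj H) (sym (strictlyInverseˡ u)) (sym (strictlyInverseˡ v)) r)) ,
            (λ r → subst₂ (Adj H) (strictlyInverseˡ u) (strictlyInverseˡ v)
                  (proj₁ (adj (from u) (from v)) r))
    where open Inverse f

  module _ (iso : Isomorphic G H) where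
    open Inverse (proj₁ iso)

    private
      to-injective : ∀ {x y} → to x ≡ to y → x ≡ y
      to-injective e = trans (sym (strictlyInverseʳ _)) (trans (cong from e) (strictlyInverseʳ _))

      map-complete : ∀ {vs} → (∀ v → v ∈ vs) → ∀ w → w ∈ List.map to vs
      map-complete c w = subst (_∈ List.map to _) (strictlyInverseˡ w) (∈-map⁺ to (c (from w)))

      map-linked : ∀ {vs} → Linked (Adj G) vs → Linked (Adj H) (List.map to vs)
      map-linked l = Linked.map⁺ (Linked.map (λ {u} {v} → proj₁ (proj₂ iso u v)) l)

    hamiltonPath-map : HamiltonPath G → HamiltonPath H
    hamiltonPath-map (vs , u , c , l) =
      List.map to vs , Unique.map⁺ to-injective u , map-complete c , map-linked l

    hamiltonCycle-map : HamiltonCycle G → HamiltonCycle H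
    hamiltonCycle-map (v , vs , n , u , c , l) =
      to v , List.map to vs , subst (3 ≤_) (sym (length-map to (v ∷ vs))) n ,
      Unique.map⁺ to-injective u , map-complete c ,
      subst (Linked (Adj H)) (map-++ to (v ∷ vs) (v ∷ [])) (map-linked l)

-- Colorful triangulations as propositions

Side Diag : ℕ → ℕ → ℕ → Set
Side N i j = suc i ≡ j ⊎ (i ≡ 0 × suc j ≡ N)
Diag N i j = suc i < j × ¬ (i ≡ 0 × suc j ≡ N)

Cross : ℕ → ℕ → ℕ → ℕ → Set
Cross i j k l = (i < k × k < j × j < l) ⊎ (k < i × i < l × l < j)

side? : ∀ N i j → Dec (Side N i j)
side? N i j = (suc i ≟ j) ⊎-dec ((i ≟ 0) ×-dec (suc j ≟ N))

diag? : ∀ N i j → Dec (Diag N i j)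
diag? N i j = (suc i <? j) ×-dec ¬? ((i ≟ 0) ×-dec (suc j ≟ N))

cross? : ∀ i j k l → Dec (Cross i j k l)
cross? i j k l = ((i <? k) ×-dec (k <? j) ×-dec (j <? l)) ⊎-dec ((k <? i) ×-dec (i <? l) ×-dec (l <? j))

T-does⁻ : ∀ {P : Set} (P? : Dec P) → T (does P?) → P
T-does⁻ (yes p) _ = p

T-does⁺ : ∀ {P : Set} (P? : Dec P) → P → T (does P?)
T-does⁺ (yes _) _ = _
T-does⁺ (no ¬p) p = ¬p p

module _ {N : ℕ} {P : Fin N → Set} (P? : ∀ i → Dec (P i)) where

  -- Built on the Boolean `all1 (does ∘ P?)` itself, so that nested uses reduce to the given Boolean
  -- definitions and `does-colorfulTriangulation` can be `refl`.
  all1? : Dec (∀ i → P i)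
  all1? = all1 (does ∘ P?) because fromEquivalence
    (λ t i → T-does⁻ (P? i) (All.lookup (All.all⁺ (does ∘ P?) (allFin N) t) (∈-allFin i)))
    (λ f → All.all⁻ (does ∘ P?) {xs = allFin N} (All.tabulate (λ {i} _ → T-does⁺ (P? i) (f i))))

  any1? : Dec (∃ P)
  any1? = any1 (does ∘ P?) because fromEquivalence
    (λ t → let i , _ , p = find (Any.any⁻ (does ∘ P?) (allFin N) t) in i , T-does⁻ (P? i) p)
    (λ (i , p) → Any.any⁺ (does ∘ P?) (lose (∈-allFin i) (T-does⁺ (P? i) p)))

module _ {N : ℕ} (a : ℕ) (D : Mat N) where

  WellFormed NonCrossing Maximal Colorful : Set
  WellFormed = ∀ i j → T (edge D i j) → Diag N (toℕ i) (toℕ j)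
  NonCrossing = ∀ i j k l → ¬ (T (edge D i j) × T (edge D k l) × Cross (toℕ i) (toℕ j) (toℕ k) (toℕ l))
  Maximal = ∀ i j → Diag N (toℕ i) (toℕ j) × ¬ T (edge D i j) →
    ∃ λ k → ∃ λ l → T (edge D k l) × Cross (toℕ i) (toℕ j) (toℕ k) (toℕ l)

  Segment : Fin N → Fin N → Set
  Segment i j = Side N (toℕ i) (toℕ j) ⊎ T (edge D i j)

  Triangle Monochromatic : Fin N → Fin N → Fin N → Set
  Triangle i j k = toℕ i < toℕ j × toℕ j < toℕ k × Segment i j × Segment j k × Segment i k
  Monochromatic i j k = (toℕ i < a × toℕ j < a × toℕ k < a) ⊎ (¬ toℕ i < a × ¬ toℕ j < a × ¬ toℕ k < a)

  Colorful = ∀ i j k → ¬ (Triangle i j k × Monochromatic i j k)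

  ColorfulTriangulation : Set
  ColorfulTriangulation = (WellFormed × NonCrossing × Maximal) × Colorful

  segment? : ∀ i j → Dec (Segment i j)
  segment? i j = side? N (toℕ i) (toℕ j) ⊎-dec T? (edge D i j)

  -- Arranged so that the underlying Boolean is the one of Defs definitionally.
  colorfulTriangulation? : Dec ColorfulTriangulation
  colorfulTriangulation? =
    ((all1? λ i → all1? λ j → T? (edge D i j) →-dec diag? N (toℕ i) (toℕ j))
     ×-dec (all1? λ i → all1? λ j → all1? λ k → all1? λ l →
              ¬? (T? (edge D i j) ×-dec T? (edge D k l) ×-dec cross? (toℕ i) (toℕ j) (toℕ k) (toℕ l)))
     ×-dec (all1? λ i → all1? λ j → (diag? N (toℕ i) (toℕ j) ×-dec ¬? (T? (edge D i j))) →-dec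
              (any1? λ k → any1? λ l → T? (edge D k l) ×-dec cross? (toℕ i) (toℕ j) (toℕ k) (toℕ l))))
    ×-dec (all1? λ i → all1? λ j → all1? λ k →
      ¬? (((toℕ i <? toℕ j) ×-dec (toℕ j <? toℕ k) ×-dec segment? i j ×-dec segment? j k ×-dec segment? i k)
          ×-dec (((toℕ i <? a) ×-dec (toℕ j <? a) ×-dec (toℕ k <? a))
                 ⊎-dec (¬? (toℕ i <? a) ×-dec ¬? (toℕ j <? a) ×-dec ¬? (toℕ k <? a)))))

  does-colorfulTriangulation : does colorfulTriangulation? ≡ isTriangulation D ∧ colorful a D
  does-colorfulTriangulation = refl


-- Vertices are bounded natural numbers instead of elements of `Fin N`, because the arguments pass
-- to neighbouring vertices and do arithmetic with them. The field `crossed` expresses maximality.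
record Triangulation (N : ℕ) (E : ℕ → ℕ → Set) : Set where
  field
    E?          : ∀ i j → Dec (E i j)
    bounded     : ∀ {i j} → E i j → j < N
    diagonal    : ∀ {i j} → E i j → Diag N i j
    noncrossing : ∀ {i j k l} → E i j → E k l → ¬ Cross i j k l
    crossed     : ∀ {i j} → Diag N i j → j < N → ¬ E i j → ∃ λ k → ∃ λ l → E k l × Cross i j k l

  Seg : ℕ → ℕ → Set
  Seg i j = Side N i j ⊎ E i j

  greatest : ∀ {P : ℕ → Set} → (∀ m → Dec (P m)) → ∀ {lo} → P lo → ∀ n →
             ∃ λ m → lo ≤ m × m ≤ lo + n × P m × (∀ m′ → m < m′ → m′ ≤ lo + n → ¬ P m′)
  greatest P? {lo} p zero = lo , ≤-refl , m≤m+n lo 0 , p ,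
    λ m′ lo<m′ m′≤ _ → <⇒≱ lo<m′ (≤-trans m′≤ (≤-reflexive (+-identityʳ lo)))
  greatest {P} P? {lo} p (suc n) with P? (lo + suc n)
  ... | yes q = lo + suc n , m≤m+n lo (suc n) , ≤-refl , q , λ m′ m<m′ m′≤ _ → <⇒≱ m<m′ m′≤
  ... | no ¬q with greatest {P} P? {lo} p n
  ... | m , lo≤m , m≤ , pm , above = m , lo≤m , ≤-trans m≤ (+-monoʳ-≤ lo (n≤1+n n)) , pm , above′
    where
    above′ : ∀ m′ → m < m′ → m′ ≤ lo + suc n → ¬ P m′
    above′ m′ m<m′ m′≤ pm′ with m≤n⇒m<n∨m≡n m′≤
    ... | inj₂ refl = ¬q pm′
    ... | inj₁ m′<  = above m′ m<m′ (≤-pred (≤-trans m′< (≤-reflexive (+-suc lo n)))) pm′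

  -- The third vertex is the last one visible from i.
  triangle : ∀ {i j} → suc i < j → j < N → Seg i j → ∃ λ m → i < m × m < j × Seg i m × Seg m j
  triangle {i} {j} si<j j<N seg with m≤n⇒∃[o]m+o≡n si<j
  -- As `j` is `suc (suc i) + n`, the search runs from `suc i` to the predecessor of `j`.
  ... | n , refl with greatest (λ m → side? N i m ⊎-dec E? i m) {suc i} (inj₁ (inj₁ refl)) n
  ... | m , i<m , m≤ , seg-im , above with side? N m j | E? m j
  ... | yes s | _     = m , i<m , s≤s m≤ , seg-im , inj₁ s
  ... | no _  | yes e = m , i<m , s≤s m≤ , seg-im , inj₂ e
  -- A diagonal `{k , l}` crossing `{m , j}` would have to cross the segment `{i , j}` or `{i , m}`,
  -- or else start at `i` and make a vertex beyond `m` visible.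
  ... | no ¬s | no ¬e with crossed
        (≤∧≢⇒< (s≤s m≤) (¬s ∘ inj₁) , λ (m≡0 , _) → n≮0 (subst (i <_) m≡0 i<m)) j<N ¬e
  ... | k , l , e , inj₁ (m<k , k<j , j<l) = ⊥-elim (outer seg)
    where
    outer : ¬ Seg i j
    outer (inj₁ (inj₁ si≡j))       = <-irrefl si≡j si<j
    outer (inj₁ (inj₂ (_ , sj≡N))) = <⇒≱ (bounded e) (≤-trans (≤-reflexive (sym sj≡N)) j<l)
    outer (inj₂ e′)                = noncrossing e′ e (inj₁ (<-trans i<m m<k , k<j , j<l))
  ... | k , l , e , inj₂ (k<m , m<l , l<j) with <-cmp k i
  ... | tri≈ _ refl _ = ⊥-elim (above l m<l (≤-pred l<j) (inj₂ e))
  ... | tri< k<i _ _  = ⊥-elim (outer seg)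
    where
    outer : ¬ Seg i j
    outer (inj₁ (inj₁ si≡j))      = <-irrefl si≡j si<j
    outer (inj₁ (inj₂ (i≡0 , _))) = n≮0 (subst (k <_) i≡0 k<i)
    outer (inj₂ e′)               = noncrossing e e′ (inj₁ (k<i , <-trans i<m m<l , l<j))
  ... | tri> _ _ i<k  = ⊥-elim (inner seg-im)
    where
    inner : ¬ Seg i m
    inner (inj₁ (inj₁ refl))       = <⇒≱ k<m i<k
    inner (inj₁ (inj₂ (_ , sm≡N))) = <-irrefl sm≡N (≤-trans (s≤s m<l) (bounded e))
    inner (inj₂ e′)                = noncrossing e′ e (inj₁ (i<k , k<m , m<l))

-- Lattice paths

-- Points (x , y) of the lattice path of w, where x and y count the letters 0 and 1 still to come.
data On : Word → ℕ → ℕ → Set where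
  here  : ∀ {w x y} → x ≡ count false w → y ≡ count true w → On w x y
  there : ∀ {c w x y} → On w x y → On (c ∷ w) x y

on? : ∀ w x y → Dec (On w x y)
on? w x y with x ≟ count false w | y ≟ count true w
... | yes e | yes f = yes (here e f)
on? [] x y | yes e | no ¬f = no λ { (here _ f) → ¬f f }
on? [] x y | no ¬e | _     = no λ { (here e _) → ¬e e }
on? (c ∷ w) x y | yes e | no ¬f with on? w x y
... | yes p = yes (there p)
... | no ¬p = no λ { (here _ f) → ¬f f ; (there p) → ¬p p }
on? (c ∷ w) x y | no ¬e | _ with on? w x y
... | yes p = yes (there p)
... | no ¬p = no λ { (here e _) → ¬e e ; (there p) → ¬p p }

count-≤ : ∀ c d w → count c w ≤ count c (d ∷ w)
count-≤ true  true  w = n≤1+n _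
count-≤ true  false w = ≤-refl
count-≤ false true  w = ≤-refl
count-≤ false false w = n≤1+n _

on-≤ : ∀ {w x y} → On w x y → x ≤ count false w × y ≤ count true w
on-≤ (here refl refl) = ≤-refl , ≤-refl
on-≤ (there {c} {w} p) = let l , m = on-≤ p in ≤-trans l (count-≤ false c w) , ≤-trans m (count-≤ true c w)

on-end : ∀ w → On w 0 0
on-end []      = here refl refl
on-end (_ ∷ w) = there (on-end w)

-- Both coordinates only decrease along the path; comparability of its points is what excludes
-- crossing diagonals.
on-chain : ∀ {w x y x′ y′} → On w x y → On w x′ y′ → (x ≤ x′ × y ≤ y′) ⊎ (x′ ≤ x × y′ ≤ y)
on-chain (here refl refl) q                = inj₂ (on-≤ q)
on-chain p@(there _)      (here refl refl) = inj₁ (on-≤ p)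
on-chain (there p)        (there q)        = on-chain p q

-- Drop letters as long as the counts of the rest still bound `(x , y)`. The letter at which this
-- fails moves the path past the point in one coordinate, while the other coordinate is still
-- strictly larger.
on-maximal : ∀ w {x y} → x ≤ count false w → y ≤ count true w → ¬ On w x y →
             ∃ λ x′ → ∃ λ y′ → On w x′ y′ × ((x < x′ × y′ < y) ⊎ (x′ < x × y < y′))
on-maximal [] z≤n z≤n ¬on = ⊥-elim (¬on (here refl refl))
on-maximal (false ∷ w) {x} {y} x≤ y≤ ¬on with m≤n⇒m<n∨m≡n x≤
... | inj₁ (s≤s x≤′) = let x′ , y′ , p , c = on-maximal w x≤′ y≤ (¬on ∘ there) in x′ , y′ , there p , c
... | inj₂ refl = _ , _ , there (here refl refl) , inj₂ (≤-refl , ≤∧≢⇒< y≤ λ e → ¬on (here refl e))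
on-maximal (true ∷ w) {x} {y} x≤ y≤ ¬on with m≤n⇒m<n∨m≡n y≤
... | inj₁ (s≤s y≤′) = let x′ , y′ , p , c = on-maximal w x≤ y≤′ (¬on ∘ there) in x′ , y′ , there p , c
... | inj₂ refl = _ , _ , there (here refl refl) , inj₁ (≤∧≢⇒< x≤ (λ e → ¬on (here e refl)) , ≤-refl)

on-column : ∀ w {x} → x ≤ count false w → ∃ λ y → On w x y
on-column []          z≤n = 0 , here refl refl
on-column (true ∷ w)  x≤  = let y , p = on-column w x≤ in y , there p
on-column (false ∷ w) x≤ with m≤n⇒m<n∨m≡n x≤
... | inj₁ (s≤s x≤′) = let y , p = on-column w x≤′ in y , there p
... | inj₂ refl      = _ , here refl refl

on-row : ∀ w {y} → y ≤ count true w → ∃ λ x → On w x y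
on-row []          z≤n = 0 , here refl refl
on-row (false ∷ w) y≤  = let x , p = on-row w y≤ in x , there p
on-row (true ∷ w)  y≤ with m≤n⇒m<n∨m≡n y≤
... | inj₁ (s≤s y≤′) = let x , p = on-row w y≤′ in x , there p
... | inj₂ refl      = _ , here refl refl

-- Comparison of two lattice paths

record SameCounts (u v : Word) : Set where
  constructor _,_
  field
    zeros-same : count false u ≡ count false v
    ones-same  : count true u ≡ count true v
open SameCounts

off-true : ∀ u v → SameCounts (false ∷ u) (true ∷ v) → ¬ On (true ∷ v) (count false u) (count true u)
off-true u v (e , f) (here e′ _) = 1+n≢n (trans e (sym e′))
off-true u v (e , f) (there p)   = 1+n≰n (≤-trans (≤-reflexive (sym f)) (proj₂ (on-≤ p)))

off-false : ∀ u v → SameCounts (true ∷ u) (false ∷ v) → ¬ On (false ∷ v) (count false u) (count true u)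
off-false u v (e , f) (here _ f′) = 1+n≢n (trans f (sym f′))
off-false u v (e , f) (there p)   = 1+n≰n (≤-trans (≤-reflexive (sym e)) (proj₁ (on-≤ p)))

tail-counts : ∀ c {u v} → SameCounts (c ∷ u) (c ∷ v) → SameCounts u v
tail-counts true  (e , f) = e , suc-injective f
tail-counts false (e , f) = suc-injective e , f

off-start : ∀ c w → ¬ On w (count false (c ∷ w)) (count true (c ∷ w))
off-start true  w p = 1+n≰n (proj₂ (on-≤ p))
off-start false w p = 1+n≰n (proj₁ (on-≤ p))

same-count : ∀ c {u v} → SameCounts u v → count c u ≡ count c v
same-count true  = ones-same
same-count false = zeros-same

on-tail : ∀ c {u v x y} → count c u ≤ count c v → On u x y → On (c ∷ v) x y → On v x y
on-tail c     le p (there q)        = q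
on-tail true  le p (here refl refl) = ⊥-elim (1+n≰n (≤-trans (proj₂ (on-≤ p)) le))
on-tail false le p (here refl refl) = ⊥-elim (1+n≰n (≤-trans (proj₁ (on-≤ p)) le))

on-tail-same : ∀ c {u v x y} → SameCounts u v → On u x y → On (c ∷ v) x y → On v x y
on-tail-same c h = on-tail c (≤-reflexive (same-count c h))

-- At the first letter in which the words differ, the next point of `u` is off the path of `v`.
on-injective : ∀ u v → SameCounts u v → (∀ {x y} → On u x y → On v x y) → u ≡ v
on-injective []      []       _ _ = refl
on-injective []          (true ∷ v)  (_ , ()) _
on-injective []          (false ∷ v) (() , _) _
on-injective (true ∷ u)  []          (_ , ()) _
on-injective (false ∷ u) []          (() , _) _
on-injective (true ∷ u)  (true ∷ v)  h sub =
  cong (true ∷_) (on-injective u v (tail-counts true h) λ p → on-tail-same true (tail-counts true h) p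
        (sub (there p)))
on-injective (false ∷ u) (false ∷ v) h sub =
  cong (false ∷_) (on-injective u v (tail-counts false h) λ p → on-tail-same false
        (tail-counts false h) p (sub (there p)))
on-injective (true ∷ u)  (false ∷ v) h sub = ⊥-elim (off-false u v h (sub (there (here refl refl))))
on-injective (false ∷ u) (true ∷ v)  h sub = ⊥-elim (off-true u v h (sub (there (here refl refl))))

same-∷ : ∀ c {u v} → SameCounts u v → SameCounts (c ∷ u) (c ∷ v)
same-∷ true  (e , f) = e , cong suc f
same-∷ false (e , f) = cong suc e , f

same-sym : ∀ {u v} → SameCounts u v → SameCounts v u
same-sym (e , f) = sym e , sym f

-- The trace of an adjacent swap on the path: one corner is cut. In terms of triangulations,
-- `(x₀ , y₀)` is the diagonal that the flip removes.
Bypassed : Word → Word → ℕ → ℕ → Set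
Bypassed u v x₀ y₀ = On u x₀ y₀ × ¬ On v x₀ y₀ × (∀ {x y} → On u x y → (x ≡ x₀ × y ≡ y₀) ⊎ On v x y)

bypassed-∷ : ∀ c {u v x₀ y₀} → SameCounts u v → Bypassed u v x₀ y₀ → Bypassed (c ∷ u) (c ∷ v) x₀ y₀
bypassed-∷ c {u} {v} {x₀} {y₀} same (on , off , rest) = there on , off′ , rest′
  where
  off′ : ¬ On (c ∷ v) x₀ y₀
  off′ (there p) = off p
  off′ (here e f) = off-start c u
    (subst₂ (On u) (trans e (zeros-same (same-∷ c (same-sym same))))
          (trans f (ones-same (same-∷ c (same-sym same)))) on)
  rest′ : ∀ {x y} → On (c ∷ u) x y → (x ≡ x₀ × y ≡ y₀) ⊎ On (c ∷ v) x y
  rest′ (there p) with rest p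
  ... | inj₁ h = inj₁ h
  ... | inj₂ q = inj₂ (there q)
  rest′ (here e f) =
        inj₂ (here (trans e (zeros-same (same-∷ c same))) (trans f (ones-same (same-∷ c same))))

swap-same : ∀ {u v} → AdjSwap u v → SameCounts u v
swap-same r = count-swap false r , count-swap true r

swap-bypassed : ∀ {u v} → AdjSwap u v → ∃ λ x → ∃ λ y → Bypassed u v x y
swap-bypassed (here {true}  {true}  ne) = ⊥-elim (ne refl)
swap-bypassed (here {false} {false} ne) = ⊥-elim (ne refl)
swap-bypassed (here {true}  {false} {w} _) =
  suc (count false w) , count true w , there (here refl refl) ,
  (λ { (here _ f) → 1+n≢n (sym f) ; (there (here e _)) → 1+n≢n e ; (there (there p)) → 1+n≰n
        (proj₁ (on-≤ p)) }) ,
  λ { (here e f) → inj₂ (here e f) ; (there (here e f)) → inj₁ (e , f) ; (there (there p)) → inj₂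
        (there (there p)) }
swap-bypassed (here {false} {true} {w} _) =
  count false w , suc (count true w) , there (here refl refl) ,
  (λ { (here e _) → 1+n≢n (sym e) ; (there (here _ f)) → 1+n≢n f ; (there (there p)) → 1+n≰n
        (proj₂ (on-≤ p)) }) ,
  λ { (here e f) → inj₂ (here e f) ; (there (here e f)) → inj₁ (e , f) ; (there (there p)) → inj₂
        (there (there p)) }
swap-bypassed (there {c} r) =
  let x , y , d = swap-bypassed r in x , y , bypassed-∷ c (swap-same r) d

bypassed-tail : ∀ c {u v x₀ y₀} → SameCounts (c ∷ u) (c ∷ v) → Bypassed (c ∷ u) (c ∷ v) x₀ y₀ →
      Bypassed u v x₀ y₀
bypassed-tail c h (here e f , off , _) =
      ⊥-elim (off (here (trans e (zeros-same h)) (trans f (ones-same h))))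
bypassed-tail c {u} {v} {x₀} {y₀} h (there on , off , rest) = on , off ∘ there , rest′
  where
  rest′ : ∀ {x y} → On u x y → (x ≡ x₀ × y ≡ y₀) ⊎ On v x y
  rest′ p with rest (there p)
  ... | inj₁ e = inj₁ e
  ... | inj₂ q = inj₂ (on-tail-same c (tail-counts c h) p q)

-- The bypassed point precedes all points of `u`, so these lie on the path of `v` and `on-injective`
-- applies.
diamond : ∀ c d {u v} → SameCounts u v →
          Bypassed (c ∷ d ∷ u) (d ∷ c ∷ v) (count false (d ∷ u)) (count true (d ∷ u)) → u ≡ v
diamond c d {u} {v} h (_ , _ , rest) = on-injective u v h sub
  where
  sub : ∀ {x y} → On u x y → On v x y
  sub p with rest (there (there p))
  ... | inj₁ (refl , refl) = ⊥-elim (off-start d u p)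
  ... | inj₂ q = on-tail-same c h p
                   (on-tail d (≤-trans (≤-reflexive (same-count d h)) (count-≤ d c v)) p q)

-- The point of the left path right after the fork is off the right path, hence is the bypassed one,
-- and all later points are shared. A second 1 on the left or, after 10 on the left, a second 0 on
-- the right would put the next point off as well. This leaves 10 against 01.
fork₁₀ : ∀ u v {x₀ y₀} → SameCounts (true ∷ u) (false ∷ v) → Bypassed (true ∷ u) (false ∷ v) x₀ y₀ →
         AdjSwap (true ∷ u) (false ∷ v)
fork₁₀ u v h d@(_ , _ , rest) with rest (there (here refl refl))
... | inj₂ q = ⊥-elim (off-false u v h q)
fork₁₀ [] v (() , _) d | inj₁ _
fork₁₀ u@(_ ∷ _) [] (_ , ()) d | inj₁ _
fork₁₀ (true ∷ u) v (e , f) (_ , _ , rest) | inj₁ (refl , refl) with rest (there (there (here refl refl)))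
... | inj₁ (_ , g) = ⊥-elim (1+n≢n (sym g))
... | inj₂ (here _ g) = ⊥-elim (m≢1+m+n _ {1} (trans g (trans (sym f) (cong suc (+-comm 1 _)))))
... | inj₂ (there p) = ⊥-elim (1+n≰n (≤-trans (≤-reflexive (sym e)) (proj₁ (on-≤ p))))
fork₁₀ (false ∷ u) (false ∷ v) (e , f) (_ , _ , rest) | inj₁ (refl , refl) with rest
      (there (there (here refl refl)))
... | inj₁ (g , _) = ⊥-elim (1+n≢n (sym g))
... | inj₂ (here g _) = ⊥-elim (1+n≢n (trans e (sym g)))
... | inj₂ (there (here _ g)) = ⊥-elim (1+n≢n (trans f (sym g)))
... | inj₂ (there (there p)) =
      ⊥-elim (1+n≰n (≤-trans (≤-reflexive (sym (suc-injective e))) (proj₁ (on-≤ p))))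
fork₁₀ (false ∷ u) (true ∷ v) (e , f) d | inj₁ (refl , refl)
  with refl ← diamond true false (suc-injective e , suc-injective f) d = swap10

fork₀₁ : ∀ u v {x₀ y₀} → SameCounts (false ∷ u) (true ∷ v) → Bypassed (false ∷ u) (true ∷ v) x₀ y₀ →
         AdjSwap (false ∷ u) (true ∷ v)
fork₀₁ u v h d@(_ , _ , rest) with rest (there (here refl refl))
... | inj₂ q = ⊥-elim (off-true u v h q)
fork₀₁ [] v (_ , ()) d | inj₁ _
fork₀₁ u@(_ ∷ _) [] (() , _) d | inj₁ _
fork₀₁ (false ∷ u) v (e , f) (_ , _ , rest) | inj₁ (refl , refl) with rest (there (there (here refl refl)))
... | inj₁ (g , _) = ⊥-elim (1+n≢n (sym g))
... | inj₂ (here g _) = ⊥-elim (m≢1+m+n _ {1} (trans g (trans (sym e) (cong suc (+-comm 1 _)))))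
... | inj₂ (there p) = ⊥-elim (1+n≰n (≤-trans (≤-reflexive (sym f)) (proj₂ (on-≤ p))))
fork₀₁ (true ∷ u) (true ∷ v) (e , f) (_ , _ , rest) | inj₁ (refl , refl) with rest
      (there (there (here refl refl)))
... | inj₁ (_ , g) = ⊥-elim (1+n≢n (sym g))
... | inj₂ (here _ g) = ⊥-elim (1+n≢n (trans f (sym g)))
... | inj₂ (there (here g _)) = ⊥-elim (1+n≢n (trans e (sym g)))
... | inj₂ (there (there p)) =
      ⊥-elim (1+n≰n (≤-trans (≤-reflexive (sym (suc-injective f))) (proj₂ (on-≤ p))))
fork₀₁ (true ∷ u) (false ∷ v) (e , f) d | inj₁ (refl , refl)
  with refl ← diamond false true (suc-injective e , suc-injective f) d = swap01

bypassed-swap : ∀ u v {x₀ y₀} → SameCounts u v → Bypassed u v x₀ y₀ → AdjSwap u v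
bypassed-swap [] [] _ (on , off , _) = ⊥-elim (off on)
bypassed-swap []          (true ∷ v)  (_ , ()) _
bypassed-swap []          (false ∷ v) (() , _) _
bypassed-swap (true ∷ u)  []          (_ , ()) _
bypassed-swap (false ∷ u) []          (() , _) _
bypassed-swap (true ∷ u)  (true ∷ v)  h d =
      there (bypassed-swap u v (tail-counts true h) (bypassed-tail true h d))
bypassed-swap (false ∷ u) (false ∷ v) h d =
      there (bypassed-swap u v (tail-counts false h) (bypassed-tail false h d))
bypassed-swap (true ∷ u)  (false ∷ v) h d = fork₁₀ u v h d
bypassed-swap (false ∷ u) (true ∷ v)  h d = fork₀₁ u v h d

-- The isomorphism with the flip graph

T-extensional : ∀ {b c} → (T b → T c) → (T c → T b) → b ≡ c
T-extensional {true}  {true}  _ _ = refl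
T-extensional {true}  {false} f _ = ⊥-elim (f _)
T-extensional {false} {true}  _ g = ⊥-elim (g _)
T-extensional {false} {false} _ _ = refl

T⇒true : ∀ {b} → T b → b ≡ true
T⇒true {true} _ = refl

true⇒T : ∀ {b} → b ≡ true → T b
true⇒T refl = _

¬T⇒false : ∀ {b} → ¬ T b → b ≡ false
¬T⇒false {true}  h = ⊥-elim (h _)
¬T⇒false {false} _ = refl

module _ {N : ℕ} where

  matrix-extensional : {D D′ : Mat N} → (∀ i j → edge D i j ≡ edge D′ i j) → D ≡ D′
  matrix-extensional e = lookup-ext (λ i → lookup-ext (e i))
    where
    lookup-ext : ∀ {A : Set} {u v : Vec A N} → (∀ i → lookup u i ≡ lookup v i) → u ≡ v
    lookup-ext {u = u} {v} h = trans (sym (tabulate∘lookup u)) (trans (tabulate-cong h) (tabulate∘lookup v))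

  edge-setE : ∀ (D : Mat N) i j b → edge (setE D i j b) i j ≡ b
  edge-setE D i j b = trans (cong (λ v → lookup v j) (lookup∘update i D _)) (lookup∘update j (lookup D i) b)

  edge-setE′ : ∀ (D : Mat N) i j b {p q} → ¬ (p ≡ i × q ≡ j) → edge (setE D i j b) p q ≡ edge D p q
  edge-setE′ D i j b {p} {q} ne with p ≟ᶠ i
  ... | no p≢i   = cong (λ v → lookup v q) (lookup∘update′ p≢i D _)
  ... | yes refl = trans (cong (λ v → lookup v q) (lookup∘update p D _))
                         (lookup∘update′ (λ e → ne (refl , e)) (lookup D p) b)

diag-¬side : ∀ {N i j} → Diag N i j → ¬ Side N i j
diag-¬side (lt , _)  (inj₁ e) = <-irrefl e lt
diag-¬side (_ , ¬e) (inj₂ e) = ¬e e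

module _ (s t : ℕ) where

  N : ℕ
  N = suc s + suc t

  -- Red vertices are 0 to `s`. The coordinates count the red and blue steps remaining until the
  -- side `{s , s+1}`, and the two bounds make the truncated subtractions invertible. `Diag` removes
  -- the ends `(s , t)` and `(0 , 0)` of the path, which are sides.
  PathEdge : Word → ℕ → ℕ → Set
  PathEdge w i j = Diag N i j × i ≤ s × suc s ≤ j × On w (s ∸ i) (j ∸ suc s)

  pathEdge? : ∀ w i j → Dec (PathEdge w i j)
  pathEdge? w i j = diag? N i j ×-dec (i ≤? s) ×-dec (suc s ≤? j) ×-dec on? w (s ∸ i) (j ∸ suc s)

  pathRow : Word → Fin N → Vec Bool N
  pathRow w i = tabulate λ j → does (pathEdge? w (toℕ i) (toℕ j))

  encode : Word → Mat N
  encode w = tabulate (pathRow w)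

  edge-encode : ∀ w i j → edge (encode w) i j ≡ does (pathEdge? w (toℕ i) (toℕ j))
  edge-encode w i j =
    trans (cong (λ v → lookup v j) (lookup∘tabulate (pathRow w) i))
          (lookup∘tabulate (λ j → does (pathEdge? w (toℕ i) (toℕ j))) j)

  encode⁻ : ∀ w i j → T (edge (encode w) i j) → PathEdge w (toℕ i) (toℕ j)
  encode⁻ w i j e = T-does⁻ (pathEdge? w (toℕ i) (toℕ j)) (subst T (edge-encode w i j) e)

  encode⁺ : ∀ w i j → PathEdge w (toℕ i) (toℕ j) → T (edge (encode w) i j)
  encode⁺ w i j e = subst T (sym (edge-encode w i j)) (T-does⁺ (pathEdge? w (toℕ i) (toℕ j)) e)

  Valid : Word → Set
  Valid w = count false w ≡ s × count true w ≡ t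

  Interior : ℕ → ℕ → Set
  Interior x y = ¬ (x ≡ 0 × y ≡ 0) × ¬ (x ≡ s × y ≡ t)

  not-last : ∀ {x y} → x ≤ s → ¬ (x ≡ 0 × y ≡ 0) → suc (s ∸ x) < suc s + y
  not-last {x} {y} x≤s ¬0 = ≤∧≢⇒< (s≤s (≤-trans (m∸n≤m s x) (m≤m+n s y))) λ e →
    ¬0 (x≡0 (suc-injective e) , n≤0⇒n≡0 (+-cancelˡ-≤ s y 0 (begin
      s + y ≡⟨ sym (suc-injective e) ⟩ s ∸ x ≤⟨ m∸n≤m s x ⟩ s ≡⟨ sym (+-identityʳ s) ⟩ s + 0 ∎)))
    where
    open ≤-Reasoning
    x≡0 : s ∸ x ≡ s + y → x ≡ 0
    x≡0 e = n≤0⇒n≡0 (begin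
      x            ≡⟨ sym (m∸[m∸n]≡n x≤s) ⟩
      s ∸ (s ∸ x)  ≡⟨ cong (s ∸_) e ⟩
      s ∸ (s + y)  ≡⟨ m≤n⇒m∸n≡0 (m≤m+n s y) ⟩
      0            ∎)

  on-edge : ∀ {w x y} → x ≤ s → Interior x y → On w x y → PathEdge w (s ∸ x) (suc s + y)
  on-edge {w} {x} {y} x≤s (¬0 , ¬st) on =
    (not-last x≤s ¬0 , λ (e , f) → ¬st
      ( trans (sym (m∸[m∸n]≡n x≤s)) (cong (s ∸_) e)
      , +-cancelˡ-≡ s y t (suc-injective (trans (suc-injective f) (+-suc s t))))) ,
    m∸n≤m s x , m≤m+n (suc s) y ,
    subst₂ (On w) (sym (m∸[m∸n]≡n x≤s)) (sym (m+n∸m≡n (suc s) y)) on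

  below : ∀ {j} → j < N → j ∸ suc s ≤ t
  below {j} j<N = ≤-trans (∸-monoˡ-≤ (suc s) (≤-pred (≤-trans j<N (≤-reflexive (+-suc (suc s) t)))))
                          (≤-reflexive (m+n∸m≡n (suc s) t))

  above : ∀ {y} → y ≤ t → suc s + y < N
  above y≤t = ≤-trans (s≤s (+-monoʳ-≤ (suc s) y≤t)) (≤-reflexive (sym (+-suc (suc s) t)))

  module _ {w : Word} (valid : Valid w) where

    private
      e = proj₁ valid
      f = proj₂ valid

    on-bounds : ∀ {x y} → On w x y → x ≤ s × y ≤ t
    on-bounds p = ≤-trans (proj₁ (on-≤ p)) (≤-reflexive e) , ≤-trans (proj₂ (on-≤ p)) (≤-reflexive f)

    pathEdge-bounded : ∀ {i j} → PathEdge w i j → i < N × j < N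
    pathEdge-bounded {i} {j} (_ , i≤s , s<j , on) =
      ≤-trans (s≤s i≤s) (m≤m+n (suc s) (suc t)) ,
      subst (_< N) (m+[n∸m]≡n s<j) (above (proj₂ (on-bounds on)))

    pathEdge-noncrossing : ∀ {i j k l} → PathEdge w i j → PathEdge w k l → ¬ Cross i j k l
    pathEdge-noncrossing (_ , _ , s<j , p) (_ , k≤s , _ , q) (inj₁ (i<k , _ , j<l)) with on-chain p q
    ... | inj₁ (x≤ , _) = <⇒≱ (∸-monoʳ-< i<k k≤s) x≤
    ... | inj₂ (_ , y≤) = <⇒≱ (∸-monoˡ-< j<l s<j) y≤
    pathEdge-noncrossing (_ , i≤s , _ , p) (_ , _ , s<l , q) (inj₂ (k<i , _ , l<j)) with on-chain p q
    ... | inj₁ (_ , y≤) = <⇒≱ (∸-monoˡ-< l<j s<l) y≤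
    ... | inj₂ (x≤ , _) = <⇒≱ (∸-monoʳ-< k<i i≤s) x≤

    pathEdge-crossed : ∀ {i j} → Diag N i j → j < N → ¬ PathEdge w i j →
                       ∃ λ k → ∃ λ l → PathEdge w k l × Cross i j k l
    pathEdge-crossed {i} {j} diag@(si<j , _) j<N ¬e with i ≤? s | suc s ≤? j
    ... | yes i≤s | yes s<j
      -- Changing `x` and `y` in opposite directions shifts both endpoints the same way, so the
      -- diagonal found crosses `{i , j}`.
      with on-maximal w (≤-trans (m∸n≤m s i) (≤-reflexive (sym e)))
            (≤-trans (below j<N) (≤-reflexive (sym f)))
                      (λ on → ¬e (diag , i≤s , s<j , on))
    ... | x , y , on , inj₁ (x< , y<) =
      s ∸ x , suc s + y ,
      on-edge x≤s ((λ (x≡0 , _) → n≮0 (subst (_ <_) x≡0 x<)) ,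
            (λ (_ , y≡t) → <⇒≱ y< (≤-trans (below j<N) (≤-reflexive (sym y≡t))))) on ,
      inj₂ (subst (s ∸ x <_) (m∸[m∸n]≡n i≤s) (∸-monoʳ-< x< x≤s) , ≤-trans (s≤s i≤s) (m≤m+n (suc s) y) ,
            subst (suc s + y <_) (m+[n∸m]≡n s<j) (+-monoʳ-< (suc s) y<))
      where x≤s = proj₁ (on-bounds on)
    ... | x , y , on , inj₂ (x< , y<) =
      s ∸ x , suc s + y ,
      on-edge x≤s ((λ (_ , y≡0) → n≮0 (subst (_ <_) y≡0 y<)) ,
            (λ (x≡s , _) → <⇒≱ x< (≤-trans (m∸n≤m s i) (≤-reflexive (sym x≡s))))) on ,
      inj₁ (subst (_< s ∸ x) (m∸[m∸n]≡n i≤s) (∸-monoʳ-< x< (m∸n≤m s i)) , ≤-trans (s≤s (m∸n≤m s x)) s<j ,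
            subst (_< suc s + y) (m+[n∸m]≡n s<j) (+-monoʳ-< (suc s) y<))
      where x≤s = proj₁ (on-bounds on)
    -- Two red endpoints: the red vertex `suc i` lies strictly between them, and the path has a
    -- point in its column.
    pathEdge-crossed {i} {j} (si<j , _) j<N ¬e | yes i≤s | no s≮j
      with on-column w {s ∸ suc i} (≤-trans (m∸n≤m s (suc i)) (≤-reflexive (sym e)))
    ... | y , on = s ∸ (s ∸ suc i) , suc s + y ,
      on-edge (m∸n≤m s (suc i)) ((λ (x≡0 , _) → <⇒≱ si<s (m∸n≡0⇒m≤n x≡0)) , λ (x≡s , _) → 1+n≢0
            (trans (sym back) (trans (cong (s ∸_) x≡s) (n∸n≡0 s)))) on ,
      inj₁ (subst (i <_) (sym back) ≤-refl , subst (_< j) (sym back) si<j , ≤-trans (s≤s j≤s)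
            (m≤m+n (suc s) y))
      where
      j≤s : j ≤ s
      j≤s = ≤-pred (≰⇒> s≮j)
      si<s : suc i < s
      si<s = ≤-trans si<j j≤s
      back : s ∸ (s ∸ suc i) ≡ suc i
      back = m∸[m∸n]≡n (<⇒≤ si<s)
    -- Two blue endpoints: the row `i ∸ s` belongs to the blue vertex `suc i`, strictly between
    -- them.
    pathEdge-crossed {i} {j} (si<j , _) j<N ¬e | no i≰s | _
      with on-row w {i ∸ s} (≤-trans (below (<-trans si<j j<N)) (≤-reflexive (sym f)))
    ... | x , on = s ∸ x , suc s + (i ∸ s) ,
      on-edge x≤s ((λ (_ , y≡0) → i≰s (m∸n≡0⇒m≤n y≡0)) ,
                   λ (_ , y≡t) → <⇒≱ j<N (≤-trans (≤-reflexive
                         (trans (+-suc (suc s) t) (cong suc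
                               (trans (cong (suc s +_) (sym y≡t)) back)))) si<j)) on ,
      inj₂ (≤-trans (s≤s (m∸n≤m s x)) s<i , subst (i <_) (sym back) ≤-refl , subst (_< j) (sym back) si<j)
      where
      s<i : s < i
      s<i = ≰⇒> i≰s
      back : suc s + (i ∸ s) ≡ suc i
      back = m+[n∸m]≡n (s≤s (<⇒≤ s<i))
      x≤s = proj₁ (on-bounds on)

    encode-colorfulTriangulation : ColorfulTriangulation (suc s) (encode w)
    encode-colorfulTriangulation =
      ( (λ i j p → proj₁ (encode⁻ w i j p))
      , (λ i j k l (p , q , c) → pathEdge-noncrossing (encode⁻ w i j p) (encode⁻ w k l q) c)
      , λ i j (d , ¬p) → toFin (pathEdge-crossed d (toℕ<n j) (¬p ∘ encode⁺ w i j)))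
      -- The segment `{i , k}` decides: a diagonal of the path and the side `{0 , N-1}` both join
      -- the two colours, and no vertex `j` fits between the ends of any other side.
      , λ { i j k ((i<j , j<k , _ , _ , inj₂ p) , inj₁ (_ , _ , k≤s)) → <⇒≱ k≤s
            (proj₁ (proj₂ (proj₂ (encode⁻ w i k p))))
          ; i j k ((i<j , j<k , _ , _ , inj₂ p) , inj₂ (i≰s , _ , _)) → i≰s
                (s≤s (proj₁ (proj₂ (encode⁻ w i k p))))
          ; i j k ((i<j , j<k , _ , _ , inj₁ (inj₁ e)) , _) → <⇒≱ (≤-trans (s≤s i<j) j<k)
                (≤-reflexive (sym e))
          ; i j k ((i<j , j<k , _ , _ , inj₁ (inj₂ (_ , e))) , inj₁ (_ , _ , k≤s)) → m+1+n≰m (suc s)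
                (≤-trans (≤-reflexive (sym e)) k≤s)
          ; i j k ((i<j , j<k , _ , _ , inj₁ (inj₂ (e , _))) , inj₂ (i≰s , _ , _)) → i≰s
                (s≤s (≤-trans (≤-reflexive e) z≤n)) }
      where
      toFin : ∀ {i j} → (∃ λ k → ∃ λ l → PathEdge w k l × Cross i j k l) →
              ∃ λ k → ∃ λ l → T (edge (encode w) k l) × Cross i j (toℕ k) (toℕ l)
      toFin {i} {j} (k , l , p , c) =
        let k<N , l<N = pathEdge-bounded p
            ek = sym (toℕ-fromℕ< k<N)
            el = sym (toℕ-fromℕ< l<N)
        in fromℕ< k<N , fromℕ< l<N , encode⁺ w (fromℕ< k<N) (fromℕ< l<N)
              (subst₂ (PathEdge w) ek el p) , subst₂ (Cross i j) ek el c

  sameCounts : ∀ {u v} → Valid u → Valid v → SameCounts u v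
  sameCounts (e , f) (e′ , f′) = trans e (sym e′) , trans f (sym f′)

  data Point (w : Word) (x y : ℕ) : Set where
    isLast  : x ≡ 0 → y ≡ 0 → Point w x y
    isFirst : x ≡ s → y ≡ t → Point w x y
    atEdge  : ∀ (i j : Fin N) → x ≡ s ∸ toℕ i → y ≡ toℕ j ∸ suc s → PathEdge w (toℕ i) (toℕ j) → Point w x y

  point : ∀ {w x y} → Valid w → On w x y → Point w x y
  point {w} {x} {y} h on with (x ≟ 0) ×-dec (y ≟ 0) | (x ≟ s) ×-dec (y ≟ t)
  ... | yes (e , f) | _           = isLast e f
  ... | no _        | yes (e , f) = isFirst e f
  ... | no ¬0       | no ¬st      =
    let x≤s = proj₁ (on-bounds h on)
        p = on-edge x≤s (¬0 , ¬st) on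
        i<N , j<N = pathEdge-bounded h p
        ei = toℕ-fromℕ< i<N
        ej = toℕ-fromℕ< j<N
    in atEdge (fromℕ< i<N) (fromℕ< j<N)
         (trans (sym (m∸[m∸n]≡n x≤s)) (cong (s ∸_) (sym ei)))
         (trans (sym (m+n∸m≡n (suc s) y)) (cong (_∸ suc s) (sym ej)))
         (subst₂ (PathEdge w) (sym ei) (sym ej) p)

  on-first : ∀ {w x y} → Valid w → x ≡ s → y ≡ t → On w x y
  on-first (e , f) e′ f′ = here (trans e′ (sym e)) (trans f′ (sym f))

  on-last : ∀ w {x y} → x ≡ 0 → y ≡ 0 → On w x y
  on-last w refl refl = on-end w

  onPath : ∀ {w i j} → PathEdge w i j → On w (s ∸ i) (j ∸ suc s)
  onPath (_ , _ , _ , on) = on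

  relocate : ∀ {u v i j} → PathEdge u i j → On v (s ∸ i) (j ∸ suc s) → PathEdge v i j
  relocate (d , i≤s , s<j , _) on = d , i≤s , s<j , on

  encode-injective : ∀ {u v} → Valid u → Valid v → encode u ≡ encode v → u ≡ v
  encode-injective {u} {v} hu hv e = on-injective u v (sameCounts hu hv) sub
    where
    sub : ∀ {x y} → On u x y → On v x y
    sub on with point hu on
    ... | isLast e f  = on-last v e f
    ... | isFirst e f = on-first hv e f
    ... | atEdge i j refl refl p = onPath (encode⁻ v i j (subst (λ D → T (edge D i j)) e (encode⁺ u i j p)))

  edge-determines : ∀ {w w′} {i j k l : Fin N} → PathEdge w (toℕ i) (toℕ j) → PathEdge w′ (toℕ k) (toℕ l) →
    s ∸ toℕ i ≡ s ∸ toℕ k → toℕ j ∸ suc s ≡ toℕ l ∸ suc s → i ≡ k × j ≡ l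
  edge-determines (_ , i≤s , s<j , _) (_ , k≤s , s<l , _) e f =
    toℕ-injective (∸-cancelˡ-≡ i≤s k≤s e) , toℕ-injective (∸-cancelʳ-≡ s<j s<l f)

  -- All diagonals of `u` except the removed one survive in `v`, so its lattice point is the only
  -- one lost, as `bypassed-swap` demands.
  flip⇒swap : ∀ {u v} → Valid u → Valid v → Flip (encode u) (encode v) → AdjSwap u v
  flip⇒swap {u} {v} hu hv (i , j , k , l , e , e′ , eq) =
    bypassed-swap u v (sameCounts hu hv) (onPath old , gone , rest)
    where
    D : Mat N
    D = setE (encode u) i j false
    new : ∀ p q → edge (encode v) p q ≡ edge (setE D k l true) p q
    new p q = cong (λ D → edge D p q) eq
    old : PathEdge u (toℕ i) (toℕ j)
    old = encode⁻ u i j (true⇒T e)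
    kl≢ij : ¬ (i ≡ k × j ≡ l)
    kl≢ij (refl , refl) with () ← trans (sym e) e′
    gone : ¬ On v (s ∸ toℕ i) (toℕ j ∸ suc s)
    gone on with () ← trans (sym (T⇒true (encode⁺ v i j (relocate {u} {v} old on))))
                        (trans (new i j) (trans (edge-setE′ D k l true kl≢ij)
                              (edge-setE (encode u) i j false)))
    kept : ∀ p q → ¬ (p ≡ i × q ≡ j) → T (edge (encode u) p q) → T (edge (encode v) p q)
    kept p q ne h with (p ≟ᶠ k) ×-dec (q ≟ᶠ l)
    ... | yes (refl , refl) = true⇒T (trans (new p q) (edge-setE D p q true))
    ... | no ne′ =
          subst T (sym (trans (new p q) (trans (edge-setE′ D k l true ne′)
                (edge-setE′ (encode u) i j false ne)))) h
    rest : ∀ {x y} → On u x y → (x ≡ s ∸ toℕ i × y ≡ toℕ j ∸ suc s) ⊎ On v x y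
    rest on with point hu on
    ... | isLast e f  = inj₂ (on-last v e f)
    ... | isFirst e f = inj₂ (on-first hv e f)
    ... | atEdge p q refl refl h with (p ≟ᶠ i) ×-dec (q ≟ᶠ j)
    ... | yes (refl , refl) = inj₁ (refl , refl)
    ... | no ne = inj₂ (onPath (encode⁻ v p q (kept p q ne (encode⁺ u p q h))))

  bypassed-edge : ∀ {u v x y} → Valid u → Valid v → Bypassed u v x y →
    ∃ λ (i : Fin N) → ∃ λ (j : Fin N) → PathEdge u (toℕ i) (toℕ j) × ¬ PathEdge v (toℕ i) (toℕ j) ×
      (∀ (p q : Fin N) → ¬ (p ≡ i × q ≡ j) → PathEdge u (toℕ p) (toℕ q) → PathEdge v (toℕ p) (toℕ q))
  bypassed-edge {u} {v} hu hv (on , off , rest) with point hu on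
  ... | isLast e f  = ⊥-elim (off (on-last v e f))
  ... | isFirst e f = ⊥-elim (off (on-first hv e f))
  ... | atEdge i j refl refl h = i , j , h , off ∘ onPath , kept
    where
    kept : ∀ (p q : Fin N) → ¬ (p ≡ i × q ≡ j) → PathEdge u (toℕ p) (toℕ q) → PathEdge v (toℕ p) (toℕ q)
    kept p q ne h′ with rest (onPath h′)
    ... | inj₁ (e , f) = ⊥-elim (ne (edge-determines {u} {u} h′ h e f))
    ... | inj₂ on′     = relocate {u} {v} h′ on′

  -- The removed diagonal is the point of `u` bypassed by `v`; the added one is the point of `v`
  -- bypassed by `u`, found by reversing the swap.
  swap⇒flip : ∀ {u v} → Valid u → Valid v → AdjSwap u v → Flip (encode u) (encode v)
  swap⇒flip {u} {v} hu hv r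
    with bypassed-edge hu hv (proj₂ (proj₂ (swap-bypassed r)))
       | bypassed-edge hv hu (proj₂ (proj₂ (swap-bypassed (swap-sym r))))
  ... | i , j , old , ¬old , keep | k , l , new , ¬new , keep′ =
    i , j , k , l , T⇒true (encode⁺ u i j old) , ¬T⇒false (¬new ∘ encode⁻ u k l) , matrix-extensional same
    where
    D : Mat N
    D = setE (encode u) i j false
    same : ∀ p q → edge (encode v) p q ≡ edge (setE D k l true) p q
    same p q with (p ≟ᶠ k) ×-dec (q ≟ᶠ l) | (p ≟ᶠ i) ×-dec (q ≟ᶠ j)
    ... | yes (refl , refl) | _ = trans (T⇒true (encode⁺ v p q new)) (sym (edge-setE D p q true))
    ... | no ne | yes (refl , refl) =
      trans (¬T⇒false (¬old ∘ encode⁻ v p q))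
            (sym (trans (edge-setE′ D k l true ne) (edge-setE (encode u) p q false)))
    ... | no ne | no ne′ =
      trans (T-extensional (λ h → encode⁺ u p q (keep′ p q ne (encode⁻ v p q h)))
                           (λ h → encode⁺ v p q (keep p q ne′ (encode⁻ u p q h))))
            (sym (trans (edge-setE′ D k l true ne) (edge-setE′ (encode u) i j false ne′)))

  -- Reading a word off a colorful triangulation

  module _ {D : Mat N} (good : ColorfulTriangulation (suc s) D) where

    private
      wf = proj₁ (proj₁ good)
      nc = proj₁ (proj₂ (proj₁ good))
      mx = proj₂ (proj₂ (proj₁ good))
      cf = proj₂ good

    Edge : ℕ → ℕ → Set
    Edge i j = Σ (i < N) λ i<N → Σ (j < N) λ j<N → T (edge D (fromℕ< i<N) (fromℕ< j<N))

    edge⁺ : ∀ {p q} → T (edge D p q) → Edge (toℕ p) (toℕ q)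
    edge⁺ {p} {q} h = toℕ<n p , toℕ<n q ,
      subst₂ (λ p q → T (edge D p q)) (sym (fromℕ<-toℕ p (toℕ<n p))) (sym (fromℕ<-toℕ q (toℕ<n q))) h

    edge⁻ : ∀ {p q} → Edge (toℕ p) (toℕ q) → T (edge D p q)
    edge⁻ {p} {q} (p<N , q<N , h) =
      subst₂ (λ p q → T (edge D p q)) (fromℕ<-toℕ p p<N) (fromℕ<-toℕ q q<N) h

    edge? : ∀ i j → Dec (Edge i j)
    edge? i j with i <? N | j <? N
    ... | no ¬i   | _       = no (¬i ∘ proj₁)
    ... | yes _   | no ¬j   = no (¬j ∘ proj₁ ∘ proj₂)
    ... | yes i<N | yes j<N with T? (edge D (fromℕ< i<N) (fromℕ< j<N))
    ... | yes h = yes (i<N , j<N , h)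
    ... | no ¬h = no λ { (_ , _ , h) → ¬h h }

    triangulation : Triangulation N Edge
    triangulation = record
      { E?          = edge?
      ; bounded     = λ (_ , j<N , _) → j<N
      ; diagonal    = λ (i<N , j<N , h) → subst₂ (Diag N) (toℕ-fromℕ< i<N) (toℕ-fromℕ< j<N) (wf _ _ h)
      ; noncrossing = λ (i<N , j<N , h) (k<N , l<N , h′) c → nc _ _ _ _
          (h , h′ , cross (sym (toℕ-fromℕ< i<N)) (sym (toℕ-fromℕ< j<N)) (sym (toℕ-fromℕ< k<N))
                (sym (toℕ-fromℕ< l<N)) c)
      ; crossed     = λ {i} {j} d j<N ¬h →
          let i<N = <-trans (<-trans (n<1+n i) (proj₁ d)) j<N
              k , l , h , c = mx (fromℕ< i<N) (fromℕ< j<N)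
                ( subst₂ (Diag N) (sym (toℕ-fromℕ< i<N)) (sym (toℕ-fromℕ< j<N)) d
                , λ h → ¬h (i<N , j<N , h))
          in toℕ k , toℕ l , edge⁺ h , cross (toℕ-fromℕ< i<N) (toℕ-fromℕ< j<N) refl refl c
      }
      where
      cross : ∀ {i j k l i′ j′ k′ l′} → i ≡ i′ → j ≡ j′ → k ≡ k′ → l ≡ l′ → Cross i j k l →
            Cross i′ j′ k′ l′
      cross refl refl refl refl c = c

    open Triangulation triangulation using (Seg; triangle)

    seg-fin : ∀ {i j} (i<N : i < N) (j<N : j < N) → Seg i j → Segment (suc s) D (fromℕ< i<N) (fromℕ< j<N)
    seg-fin i<N j<N (inj₁ e) = inj₁ (subst₂ (Side N) (sym (toℕ-fromℕ< i<N)) (sym (toℕ-fromℕ< j<N)) e)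
    seg-fin i<N j<N (inj₂ (_ , _ , h)) = inj₂ h

    no-monochromatic : ∀ {i j k} → i < j → j < k → k < N → Seg i j → Seg j k → Seg i k → ¬ (k ≤ s ⊎ s < i)
    no-monochromatic {i} {j} {k} i<j j<k k<N a b c col =
      cf (fromℕ< i<N) (fromℕ< j<N) (fromℕ< k<N)
        ((subst₂ _<_ (sym ei) (sym ej) i<j , subst₂ _<_ (sym ej) (sym ek) j<k ,
          seg-fin i<N j<N a , seg-fin j<N k<N b , seg-fin i<N k<N c) , mono col)
      where
      j<N = <-trans j<k k<N
      i<N = <-trans i<j j<N
      ei = toℕ-fromℕ< i<N
      ej = toℕ-fromℕ< j<N
      ek = toℕ-fromℕ< k<N
      mono : k ≤ s ⊎ s < i → Monochromatic (suc s) D (fromℕ< i<N) (fromℕ< j<N) (fromℕ< k<N)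
      mono (inj₁ k≤s) = inj₁ (subst (_< suc s) (sym ei) (s≤s (<⇒≤ (<-trans i<j (≤-trans j<k k≤s)))) ,
                              subst (_< suc s) (sym ej) (s≤s (<⇒≤ (≤-trans j<k k≤s))) ,
                              subst (_< suc s) (sym ek) (s≤s k≤s))
      mono (inj₂ s<i) = inj₂ ((λ h → <⇒≱ s<i (≤-pred (subst (_< suc s) ei h))) ,
                              (λ h → <⇒≱ (<-trans s<i i<j) (≤-pred (subst (_< suc s) ej h))) ,
                              (λ h → <⇒≱ (<-trans s<i (<-trans i<j j<k)) (≤-pred (subst (_< suc s) ek h))))

    same-colour-side : ∀ {i j} → i < j → j < N → Seg i j → (j ≤ s ⊎ s < i) → suc i ≡ j
    same-colour-side {i} {j} i<j j<N seg col with suc i ≟ j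
    ... | yes e = e
    ... | no ne =
      let m , i<m , m<j , a , b = triangle (≤∧≢⇒< i<j ne) j<N seg
      in ⊥-elim (no-monochromatic i<m m<j j<N a b seg col)

    -- The third vertex `m` of the triangle shares its colour with one endpoint. By
    -- `same-colour-side` the segment between them is a side, so `m` is `suc i` or `j`.
    advance : ∀ {i j} → suc i < suc j → suc j < N → i ≤ s → s ≤ j → Seg i (suc j) →
              (suc i ≤ s × Seg (suc i) (suc j)) ⊎ (suc s ≤ j × Seg i j)
    advance {i} {j} lt j<N i≤s s≤j seg with triangle lt j<N seg
    ... | m , i<m , m<j , a , b with m ≤? s
    ... | yes m≤s with refl ← same-colour-side i<m (<-trans m<j j<N) a (inj₁ m≤s) = inj₁ (m≤s , b)
    ... | no m≰s  with refl ← same-colour-side m<j j<N b (inj₂ (≰⇒> m≰s)) = inj₂ (≰⇒> m≰s , a)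

    Follows : Word → Set
    Follows w = ∀ {x y} → On w x y → Seg (s ∸ x) (suc s + y)

    Continues : ℕ → ℕ → Set
    Continues x y = ∃ λ w → count false w ≡ x × count true w ≡ y × Follows w

    left : ∀ {x y} → Seg (s ∸ suc x) (suc s + y) → Continues x y → Continues (suc x) y
    left seg (w , refl , refl , h) =
          false ∷ w , refl , refl , λ { (here refl refl) → seg ; (there p) → h p }

    down : ∀ {x y} → Seg (s ∸ x) (suc s + suc y) → Continues x y → Continues x (suc y)
    down seg (w , refl , refl , h) = true ∷ w , refl , refl , λ { (here refl refl) → seg ; (there p) → h p }

    advance′ : ∀ {x y} → x ≤ s → suc y ≤ t → Seg (s ∸ x) (suc s + suc y) →
               (suc (s ∸ x) ≤ s × Seg (suc (s ∸ x)) (suc s + suc y)) ⊎ Seg (s ∸ x) (suc s + y)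
    advance′ {x} {y} x≤s y<t seg with advance (not-last x≤s (λ ())) (above y<t) (m∸n≤m s x)
          (m≤m+n s (suc y)) seg
    ... | inj₁ h       = inj₁ h
    ... | inj₂ (_ , h) = inj₂ (subst (Seg (s ∸ x)) (+-suc s y) h)

    retreat : ∀ {x j} → suc x ≤ s → Seg (suc (s ∸ suc x)) j → Seg (s ∸ x) j
    retreat {x} {j} x<s = subst (λ i → Seg i j) (sym (+-∸-assoc 1 x<s))

    follow : ∀ x y → x ≤ s → y ≤ t → Seg (s ∸ x) (suc s + y) → Continues x y
    follow zero    zero    _   _   seg = [] , refl , refl , λ { (here refl refl) → seg }
    follow (suc x) zero    x<s y≤t seg =
      [ (λ (_ , h) → left seg (follow x zero (<⇒≤ x<s) y≤t (retreat x<s h)))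
      -- The blue endpoint is already `suc s`, the first blue vertex, so only the red one can
      -- advance.
      , (λ (h , _) → ⊥-elim (<⇒≱ h (≤-reflexive (+-identityʳ s)))) ]′
      (advance (not-last x<s (λ ())) (above y≤t) (m∸n≤m s (suc x)) (m≤m+n s 0) seg)
    follow zero    (suc y) x≤s y<t seg =
      [ (λ (h , _) → ⊥-elim (1+n≰n h))
      , (λ h → down seg (follow zero y x≤s (<⇒≤ y<t) h)) ]′
      (advance′ x≤s y<t seg)
    follow (suc x) (suc y) x<s y<t seg =
      [ (λ (_ , h) → left seg (follow x (suc y) (<⇒≤ x<s) y<t (retreat x<s h)))
      , (λ h → down seg (follow (suc x) y x<s (<⇒≤ y<t) h)) ]′
      (advance′ x<s y<t seg)

    -- The diagonals of the path belong to `D` by construction. Conversely, a diagonal of `D` off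
    -- the path would be crossed by one on the path, against noncrossing in `D`.
    follows-encode : ∀ {w} → Valid w → Follows w → encode w ≡ D
    follows-encode {w} h follows = matrix-extensional λ i j → T-extensional
      (λ p → edge⁻ (path⊆ (encode⁻ w i j p)))
      (λ p → encode⁺ w i j (⊆path i j p))
      where
      path⊆ : ∀ {i j} → PathEdge w i j → Edge i j
      path⊆ {i} {j} (d , i≤s , s<j , on)
        with subst₂ Seg (m∸[m∸n]≡n i≤s) (m+[n∸m]≡n s<j) (follows on)
      ... | inj₁ side = ⊥-elim (diag-¬side d side)
      ... | inj₂ e    = e
      ⊆path : ∀ i j → T (edge D i j) → PathEdge w (toℕ i) (toℕ j)
      ⊆path i j p with pathEdge? w (toℕ i) (toℕ j)
      ... | yes q = q
      ... | no ¬q =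
        let _ , _ , r , c = pathEdge-crossed h (wf i j p) (toℕ<n j) ¬q
        in ⊥-elim (Triangulation.noncrossing triangulation (edge⁺ p) (path⊆ r) c)

    decode : ∃ λ w → Valid w × encode w ≡ D
    decode =
      -- The path starts at `(s , t)`, which is the side `{0 , N-1}`.
      let w , e , f , h = follow s t ≤-refl ≤-refl (inj₁ (inj₂ (n∸n≡0 s , sym (+-suc (suc s) t))))
      in w , (e , f) , follows-encode (e , f) h

  F-vertex-≡ : ∀ {u v : V (F (suc s) (suc t))} → proj₁ u ≡ proj₁ v → u ≡ v
  F-vertex-≡ {D , e} {.D , e′} refl = cong (D ,_) (Decidable⇒UIP.≡-irrelevant Bool._≟_ e e′)

  colorfulTriangulation⁺ : ∀ {D : Mat N} → ColorfulTriangulation (suc s) D →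
        (isTriangulation D ∧ colorful (suc s) D) ≡ true
  colorfulTriangulation⁺ {D} h =
    trans (sym (does-colorfulTriangulation (suc s) D))
          (T⇒true (T-does⁺ (colorfulTriangulation? (suc s) D) h))

  colorfulTriangulation⁻ : ∀ {D : Mat N} → (isTriangulation D ∧ colorful (suc s) D) ≡ true →
        ColorfulTriangulation (suc s) D
  colorfulTriangulation⁻ {D} e =
    T-does⁻ (colorfulTriangulation? (suc s) D) (true⇒T (trans (does-colorfulTriangulation (suc s) D) e))

  Comb≅F : Isomorphic (Comb s t) (F (suc s) (suc t))
  Comb≅F = mk↔ₛ′ to from (λ v → F-vertex-≡ (proj₂ (proj₂ (decoded v)))) (λ u → vertex-≡
             (encode-injective (proj₁ (proj₂ (decoded (to u)))) (proj₂ (proj₂ u))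
                   (proj₂ (proj₂ (decoded (to u)))))) ,
           λ (_ , _ , hu) (_ , _ , hv) → swap⇒flip hu hv , flip⇒swap hu hv
    where
    to : V (Comb s t) → V (F (suc s) (suc t))
    to (w , _ , h) = encode w , colorfulTriangulation⁺ {encode w} (encode-colorfulTriangulation h)
    decoded : (v : V (F (suc s) (suc t))) → ∃ λ w → Valid w × encode w ≡ proj₁ v
    decoded (D , e) = decode (colorfulTriangulation⁻ {D} e)
    from : V (F (suc s) (suc t)) → V (Comb s t)
    from v = let w , (e , f) , _ = decoded v in vertex w e f

theorem3 : (a b : ℕ) → 1 ≤ a → 1 ≤ b → 3 ≤ a + b →
    Isomorphic (F a b) (Comb (a ∸ 1) (b ∸ 1))
    × ((HamiltonPath (F a b) → (a ≡ 1 ⊎ a ≡ 2 ⊎ b ≡ 1 ⊎ b ≡ 2 ⊎ (2 ∣ a × 2 ∣ b)))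
    × ((a ≡ 1 ⊎ a ≡ 2 ⊎ b ≡ 1 ⊎ b ≡ 2 ⊎ (2 ∣ a × 2 ∣ b)) → HamiltonPath (F a b)))
    × (2 ≤ a → 2 ≤ b → ¬ HamiltonCycle (F a b))
theorem3 a@(suc s) b@(suc t) 1≤a 1≤b _ =
  F≅Comb ,
  ((λ h → Comb-path-condition a b 1≤a 1≤b (hamiltonPath-map F≅Comb h)) ,
   (λ c → hamiltonPath-map (Comb≅F s t) (Comb-path a b 1≤a 1≤b c))) ,
  no-cycle
  where
  F≅Comb : Isomorphic (F a b) (Comb s t)
  F≅Comb = isomorphic-sym (Comb≅F s t)
  no-cycle : 2 ≤ a → 2 ≤ b → ¬ HamiltonCycle (F a b)
  no-cycle (s≤s (s≤s _)) (s≤s (s≤s _)) h = Comb-no-cycle _ _ (hamiltonCycle-map F≅Comb h)
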